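{- Let $q$ be a prime power and let $1\leq m\leq n/2$. The sets $$T_q(n,m)\times\prod_{X\in B_q(n)_{m-1}}\mathcal{DU}(X)\qquad\text{and}\qquad T_q(n,m-1)\times\prod_{X\in B_q(n)_m}\mathcal{UD}(X)$$ have the same cardinality.
   Context: $B_q(n)_k$ is the set of $k$-dimensional subspaces of $\mathbb{F}_q^n$. For $0\leq m\leq n/2$, the Grassmann graph $C_q(n,m)$ has vertex set $B_q(n)_m$, with $X,Y$ adjacent iff $\dim(X\cap Y)=m-1$. A rooted spanning tree of a graph is a spanning tree together with a choice of a vertex as root; $T_q(n,m)$ is the set of rooted spanning trees of $C_q(n,m)$. For $1\leq k\leq n$, $X\in B_q(n)_k$ and $X'\in B_q(n)_{k-1}$: $\mathcal{UD}(X)=\{(Y,Z)\in B_q(n)_{k-1}\times B_q(n)_k : X\supseteq Y\subseteq Z\}$ and $\mathcal{DU}(X')=\{(Y',Z')\in B_q(n)_k\times B_q(n)_{k-1}: X'\subseteq Y'\supseteq Z'\}$. The products are Cartesian products. -}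

module Defs where

open import Level using (0ℓ) renaming (suc to lsuc)
open import Data.Nat using (ℕ; zero; suc; _∸_; _≤_)
open import Data.Empty using (⊥)
open import Data.Product using (Σ; _×_; _,_; proj₁; proj₂)
open import Data.Vec using (Vec; []; _∷_; replicate; zipWith; map; lookup)
open import Data.Fin using (Fin)
open import Data.List using (List; []; _∷_; _++_; length)
open import Data.List.Membership.Propositional using (_∈_)
open import Data.List.Relation.Unary.AllPairs using (AllPairs)
open import Data.List.Relation.Unary.Linked using (Linked)
open import Relation.Nullary using (¬_)
open import Relation.Binary using (Setoid; DecidableEquality)
open import Relation.Binary.PropositionalEquality using (_≡_; _≢_; refl; sym; trans)
open import Algebra.Structures using (IsCommutativeRing)
open import Data.Product.Relation.Binary.Pointwise.NonDependent using (×-setoid)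

-- Finite fields.  A finite field is a commutative ring (with
-- propositional equality) in which 0 ≠ 1 and every non-zero element
-- has an inverse, whose carrier has decidable equality and is finitely
-- enumerated.  (Finite fields are exactly the F_q, q a prime power.)

record FiniteField : Set₁ where
  infixl 6 _+_
  infixl 7 _*_
  field
    Carrier  : Set
    _+_ _*_  : Carrier → Carrier → Carrier
    -_       : Carrier → Carrier
    0# 1#    : Carrier
    isCommutativeRing : IsCommutativeRing _≡_ _+_ _*_ -_ 0# 1#
    0≢1      : 0# ≢ 1#
    inverse  : ∀ x → x ≢ 0# → Σ Carrier (λ y → x * y ≡ 1#)
    _≟_      : DecidableEquality Carrier
    elements : List Carrier
    complete : ∀ x → x ∈ elements

module LinearAlgebra (F : FiniteField) where
  open FiniteField F

  Vector : ℕ → Set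
  Vector n = Vec Carrier n

  zeroV : ∀ {n} → Vector n
  zeroV {n} = replicate n 0#

  _+V_ : ∀ {n} → Vector n → Vector n → Vector n
  _+V_ = zipWith _+_

  _·V_ : ∀ {n} → Carrier → Vector n → Vector n
  c ·V v = map (c *_) v

  lincomb : ∀ {n k} → Vec Carrier k → Vec (Vector n) k → Vector n
  lincomb []       []       = zeroV
  lincomb (c ∷ cs) (b ∷ bs) = (c ·V b) +V lincomb cs bs

  record Subspace (n : ℕ) : Set₁ where
    field
      mem      : Vector n → Set
      mem-zero : mem zeroV
      mem-+    : ∀ {u v} → mem u → mem v → mem (u +V v)
      mem-·    : ∀ c {v} → mem v → mem (c ·V v)
  open Subspace public

  _⊆_ : ∀ {n} → Subspace n → Subspace n → Set
  X ⊆ Y = ∀ v → mem X v → mem Y v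

  _≐_ : ∀ {n} → Subspace n → Subspace n → Set
  X ≐ Y = (X ⊆ Y) × (Y ⊆ X)

  _∩_ : ∀ {n} → Subspace n → Subspace n → Subspace n
  X ∩ Y = record
    { mem      = λ v → mem X v × mem Y v
    ; mem-zero = mem-zero X , mem-zero Y
    ; mem-+    = λ p q → mem-+ X (proj₁ p) (proj₁ q) , mem-+ Y (proj₂ p) (proj₂ q)
    ; mem-·    = λ c p → mem-· X c (proj₁ p) , mem-· Y c (proj₂ p)
    }

  record Basis {n : ℕ} (X : Subspace n) (k : ℕ) : Set where
    field
      vecs  : Vec (Vector n) k
      inX   : ∀ (i : Fin k) → mem X (lookup vecs i)
      indep : ∀ (cs : Vec Carrier k) → lincomb cs vecs ≡ zeroV → cs ≡ replicate k 0#
      spans : ∀ v → mem X v → Σ (Vec Carrier k) (λ cs → lincomb cs vecs ≡ v)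

  HasDim : ∀ {n} → Subspace n → ℕ → Set
  HasDim X k = Basis X k

  BElt : ℕ → ℕ → Set₁
  BElt n k = Σ (Subspace n) (λ X → HasDim X k)

  B : ℕ → ℕ → Setoid (lsuc 0ℓ) 0ℓ
  B n k = record
    { Carrier       = BElt n k
    ; _≈_           = λ X Y → proj₁ X ≐ proj₁ Y
    ; isEquivalence = record
      { refl  = (λ v p → p) , (λ v p → p)
      ; sym   = λ e → proj₂ e , proj₁ e
      ; trans = λ e f → (λ v p → proj₁ f v (proj₁ e v p)) , (λ v p → proj₂ e v (proj₂ f v p))
      }
    }

  -- adjacency in the Grassmann graph C_q(n,m):  dim (X ∩ Y) = m - 1
  -- (for m = 0 there are no edges)
  GrassAdj : ∀ n m → BElt n m → BElt n m → Set
  GrassAdj n m X Y = Σ ℕ (λ j → (suc j ≡ m) × HasDim (proj₁ X ∩ proj₁ Y) j)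

  UDRel : ∀ n k → BElt n k → BElt n (k ∸ 1) × BElt n k → Set
  UDRel n k X (Y , Z) = (proj₁ Y ⊆ proj₁ X) × (proj₁ Y ⊆ proj₁ Z)

  DURel : ∀ n k → BElt n (k ∸ 1) → BElt n k × BElt n (k ∸ 1) → Set
  DURel n k X' (Y' , Z') = (proj₁ X' ⊆ proj₁ Y') × (proj₁ Z' ⊆ proj₁ Y')

module SpanningTrees (V : Setoid (lsuc 0ℓ) 0ℓ)
                     (Adj : Setoid.Carrier V → Setoid.Carrier V → Set) where
  open Setoid V using (_≈_) renaming (Carrier to Vt)

  data Walk (E : Vt → Vt → Set) : Vt → Vt → Set₁ where
    stop : ∀ {u v} → u ≈ v → Walk E u v
    step : ∀ {u w v} → E u w → Walk E w v → Walk E u v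

  Cycle : (Vt → Vt → Set) → Set₁
  Cycle E = Σ Vt (λ x → Σ (List Vt) (λ xs →
              (2 ≤ length xs)
            × AllPairs (λ a b → ¬ (a ≈ b)) (x ∷ xs)
            × Linked E (x ∷ xs ++ x ∷ [])))

  record SpanningTree : Set₁ where
    field
      E         : Vt → Vt → Set
      E-resp    : ∀ {u u′ v v′} → u ≈ u′ → v ≈ v′ → E u v → E u′ v′
      E-sym     : ∀ {u v} → E u v → E v u
      E-adj     : ∀ {u v} → E u v → Adj u v
      connected : ∀ u v → Walk E u v
      acyclic   : ¬ Cycle E
  open SpanningTree public

  RootedTrees : Setoid (lsuc 0ℓ) (lsuc 0ℓ)
  RootedTrees = record
    { Carrier = SpanningTree × Vt
    ; _≈_     = λ S T → (∀ u v → (E (proj₁ S) u v → E (proj₁ T) u v)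
                                × (E (proj₁ T) u v → E (proj₁ S) u v))
                        × (proj₂ S ≈ proj₂ T)
    ; isEquivalence = record
      { refl  = (λ u v → (λ p → p) , (λ p → p)) , Setoid.refl V
      ; sym   = λ e → (λ u v → proj₂ (proj₁ e u v) , proj₁ (proj₁ e u v)) , Setoid.sym V (proj₂ e)
      ; trans = λ e f → (λ u v → (λ p → proj₁ (proj₁ f u v) (proj₁ (proj₁ e u v) p))
                                , (λ p → proj₂ (proj₁ e u v) (proj₂ (proj₁ f u v) p)))
                        , Setoid.trans V (proj₂ e) (proj₂ f)
      }
    }

-- The product  ∏_{i ∈ I} { p ∈ P | R i p }  of a family of subsets of a
-- common set P indexed by a set I: well-defined choice functions,
-- compared pointwise.

ΠSetoid : (I P : Setoid (lsuc 0ℓ) 0ℓ) → (Setoid.Carrier I → Setoid.Carrier P → Set)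
        → Setoid (lsuc 0ℓ) (lsuc 0ℓ)
ΠSetoid I P R = record
  { Carrier = Σ (Setoid.Carrier I → Setoid.Carrier P) (λ f →
                (∀ {i j} → Setoid._≈_ I i j → Setoid._≈_ P (f i) (f j))
              × (∀ i → R i (f i)))
  ; _≈_ = λ f g → ∀ i → Setoid._≈_ P (proj₁ f i) (proj₁ g i)
  ; isEquivalence = record
    { refl  = λ i → Setoid.refl P
    ; sym   = λ e i → Setoid.sym P (e i)
    ; trans = λ e f i → Setoid.trans P (e i) (f i)
    }
  }

module Grassmann (F : FiniteField) where
  open LinearAlgebra F public

  T : ℕ → ℕ → Setoid (lsuc 0ℓ) (lsuc 0ℓ)
  T n m = SpanningTrees.RootedTrees (B n m) (GrassAdj n m)

  ΠDU : ℕ → ℕ → Setoid (lsuc 0ℓ) (lsuc 0ℓ)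
  ΠDU n m = ΠSetoid (B n (m ∸ 1)) (×-setoid (B n m) (B n (m ∸ 1))) (DURel n m)

  ΠUD : ℕ → ℕ → Setoid (lsuc 0ℓ) (lsuc 0ℓ)
  ΠUD n m = ΠSetoid (B n m) (×-setoid (B n (m ∸ 1)) (B n m)) (UDRel n m)

{-# OPTIONS --safe #-}
-- Let P and Q be the subspaces of dimension m − 1 and m, and let a, b be the numbers of spaces above
-- an element of P and below an element of Q; then every DU and UD set has a b elements.  Two vertices
-- of Q (of P) are adjacent exactly when they are distinct and have a common neighbour in the bipartite
-- graph P – Q, and this neighbour is unique.  Hence it suffices to compare rooted trees of the two
-- "distance two" graphs of a biregular bipartite graph.
--
-- For a weighted digraph with a ground vertex, let the forest sum be the sum, over all maps sending every
-- vertex to a vertex or to ground without producing a cycle, of the product of the weights used.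
-- If all vertices of A have the same total out-weight x, then A can be eliminated from a bipartite
-- digraph A – B: whenever y ∈ B uses i ∈ A, the successor of i may be sampled anew for y at the
-- cost of a factor x, because of the exchange identity
--     [s,u] + [u,s] = [s,s] + [u,u]
-- for the acyclicity indicators of a map with two undetermined values.  Eliminating either side and
-- giving Q ground weight ε with ε² = 0 compares the two forest sums; the coefficient of ε counts rooted trees.
module Submission where

open import Defs
open import Level using (Level; 0ℓ) renaming (suc to lsuc)
open import Algebra.Bundles using (CommutativeSemiring; Ring; CommutativeRing)
open import Algebra.Structures using (IsCommutativeSemiring; IsCommutativeRing)
open import Algebra.Structures.Biased using (isCommutativeSemiringˡ)
import Algebra.Properties.Ring as RingProperties
import Algebra.Properties.Semiring.Sum as SemiringSum
open import Axiom.UniquenessOfIdentityProofs using (module Decidable⇒UIP)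
open import Data.Bool using (Bool; true; false; _∧_)
import Data.Bool.Properties as Bool
open import Data.Empty using (⊥; ⊥-elim)
open import Data.Fin as Fin using (Fin; zero; suc; toℕ; fromℕ<)
import Data.Fin.Permutation as Perm
open import Data.Fin.Properties as Fin using (any?; all?; injective⇒≤; toℕ-injective; toℕ-fromℕ<)
open import Data.List as List using (List; []; _∷_; _++_; length)
import Data.List.Membership.DecPropositional as DecMembership
open import Data.List.Membership.Propositional using (_∈_)
open import Data.List.Properties using (map-++; length-map)
open import Data.List.Relation.Unary.All as All using (All; []; _∷_)
open import Data.List.Relation.Unary.AllPairs as AllPairs using (AllPairs; []; _∷_)
import Data.List.Relation.Unary.AllPairs.Properties as AllPairs
open import Data.List.Relation.Unary.Any using (here; there; index)
open import Data.List.Relation.Unary.Any.Properties using (lookup-index)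
open import Data.List.Relation.Unary.Linked using (Linked; []; [-]; _∷_)
import Data.List.Relation.Unary.Linked.Properties as Linked
open import Data.Maybe using (Maybe; just; nothing)
open import Data.Nat as ℕ using (ℕ; zero; suc; _≤_; _<_; s≤s; z≤n; _∸_)
open import Data.Nat.Properties as ℕ using (suc-injective)
open import Data.Nat.Tactic.RingSolver using (solve-∀)
open import Data.Product using (Σ; ∃; ∃₂; _×_; _,_; proj₁; proj₂)
open import Data.Product.Function.Dependent.Propositional using (Σ-↔)
open import Data.Product.Function.NonDependent.Propositional using (_×-↔_)
open import Data.Product.Relation.Binary.Pointwise.NonDependent using (×-setoid)
open import Data.Sum using (_⊎_; inj₁; inj₂; swap; [_,_])
open import Data.Sum.Function.Propositional using (_⊎-↔_)
open import Data.Vec using (Vec; []; _∷_; lookup; map; _[_]≔_; tabulate; replicate)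
open import Data.Vec.Properties using (lookup-map; lookup∘update; lookup∘update′; map-cong; map-∘; lookup∘tabulate; tabulate∘lookup; tabulate-cong; zipWith-assoc; zipWith-comm; zipWith-identityˡ; zipWith-identityʳ; ≡-dec)
open import Function using (_∘_; flip)
open import Function.Bundles using (Inverse; _↔_; mk↔ₛ′; mk⇔)
import Function.Construct.Composition as Compose
import Function.Construct.Symmetry as Symmetry
open import Function.Properties.Inverse using (↔-trans; ↔-sym; ↔-refl)
open import Relation.Binary using (Setoid)
open import Relation.Binary.Construct.Closure.ReflexiveTransitive using (Star; ε; _◅_; _◅◅_; reverse)
open import Relation.Binary.PropositionalEquality hiding ([_])
open import Relation.Nullary using (¬_; Dec; yes; no; does; ¬?; _×-dec_; _⊎-dec_)
open import Relation.Nullary.Decidable using (map′; dec-true; dec-false; does-⇔)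
open import Relation.Unary using (Decidable)

-- The exchange identity holds because acyclicity depends only on where s and u lead: each side
-- counts how many of the two lead to the ground. One mark may sit at many vertices, so all users of
-- an eliminated vertex can share it. Without ground edges every acyclic map has weight zero. Ground
-- weight ε keeps exactly the maps with one ground edge, the parent maps of rooted trees. The row
-- totals are then a on P and b + ε on Q, both cancellable. Although only Q has ground edges, both
-- reduced graphs end up with ground weight a ε at every vertex, so the factor a cancels and the
-- powers of a b that remain are the sizes of the two products. Elimination also creates loops, but
-- acyclic maps avoid them. No subtraction occurs: the exchange identity is summed in symmetrised
-- form and the doubling is cancelled, so the weights can be ℕ and its dual numbers. Subspaces and
-- edge sets are arbitrary predicates up to equivalence, so equal cardinality is obtained from
-- explicit bijections of both sides with the same `Fin`.

-- Acyclic maps and the search for the ground.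

-- A vector v : Vec (Fin (suc b)) b is a map defined on b vertices: the value 0 is the ground,
-- and the value suc z is the vertex z.
data Reaches {b} (v : Vec (Fin (suc b)) b) : Fin (suc b) → ℕ → Set where
  done : Reaches v zero 0
  next : ∀ {z k} → Reaches v (lookup v z) k → Reaches v (suc z) (suc k)

Acyclic : ∀ {b} → Vec (Fin (suc b)) b → Set
Acyclic v = ∀ t → ∃ (Reaches v t)

module _ {b} {v : Vec (Fin (suc b)) b} where

  Reaches-functional : ∀ {t k l} → Reaches v t k → Reaches v t l → k ≡ l
  Reaches-functional done     done     = refl
  Reaches-functional (next p) (next q) = cong suc (Reaches-functional p q)

  Reaches-visits : ∀ {t k} → Reaches v t k → (j : Fin k) →
                   ∃ λ z → Reaches v (suc z) (suc (toℕ j))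
  Reaches-visits {suc z} {suc k} (next p) j with k ℕ.≟ toℕ j
  ... | yes eq = z , subst (λ i → Reaches v (suc z) (suc i)) eq (next p)
  ... | no neq = proj₁ rec , subst (λ i → Reaches v (suc (proj₁ rec)) (suc i)) (toℕ-fromℕ< j<k) (proj₂ rec)
    where
    j<k : suc (toℕ j) ≤ k
    j<k = ℕ.≤∧≢⇒< (ℕ.≤-pred (Fin.toℕ<n j)) (λ eq → neq (sym eq))
    rec = Reaches-visits p (fromℕ< j<k)

  -- The step count is a function of the vertex, so the k vertices met on the way are distinct. The
  -- bound makes the search in `acyclic?` finite.
  Reaches-bounded : ∀ {t k} → Reaches v t k → k ≤ b
  Reaches-bounded p = injective⇒≤ {f = λ j → proj₁ (Reaches-visits p j)} inj
    where
    inj : ∀ {i j} → proj₁ (Reaches-visits p i) ≡ proj₁ (Reaches-visits p j) → i ≡ j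
    inj {i} {j} eq = toℕ-injective (suc-injective (Reaches-functional
      (subst (λ z → Reaches v (suc z) _) eq (proj₂ (Reaches-visits p i)))
      (proj₂ (Reaches-visits p j))))

module _ {b} (v : Vec (Fin (suc b)) b) where

  reaches? : ∀ t k → Dec (Reaches v t k)
  reaches? zero    zero    = yes done
  reaches? zero    (suc k) = no λ ()
  reaches? (suc z) zero    = no λ ()
  reaches? (suc z) (suc k) = map′ next (λ { (next p) → p }) (reaches? (lookup v z) k)

  abstract
    acyclic? : Dec (Acyclic v)
    acyclic? = all? λ t → map′ (λ (k , p) → toℕ k , p)
      (λ (k , p) → fromℕ< (s≤s (Reaches-bounded p)) ,
                   subst (Reaches v t) (sym (toℕ-fromℕ< _)) p)
      (any? λ (k : Fin (suc b)) → reaches? t (toℕ k))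

-- Acyclicity of a map with two undetermined values.

-- A vector over Fin (suc b) ⊎ Bool is a map with two undetermined values s and u, which are
-- marked by false and true.
fill : ∀ {A : Set} → A → A → A ⊎ Bool → A
fill s u (inj₁ t)     = t
fill s u (inj₂ false) = s
fill s u (inj₂ true)  = u

-- Where the determined part of the map leads: `nothing` is the ground, `just k` a vertex marked k.
-- The step out of the marked vertex is already counted, so such a walk has positive length, and
-- coming back to the same value strictly increases the step count.
data Ends {b} (c : Vec (Fin (suc b) ⊎ Bool) b) : Fin (suc b) → Maybe Bool → ℕ → Set where
  ground : Ends c zero nothing 0
  stop   : ∀ {z k} → lookup c z ≡ inj₂ k → Ends c (suc z) (just k) 1
  pass   : ∀ {z t e j} → lookup c z ≡ inj₁ t → Ends c t e j → Ends c (suc z) e (suc j)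

module _ {b} {c : Vec (Fin (suc b) ⊎ Bool) b} where

  Ends-positive : ∀ {t k j} → Ends c t (just k) j → ∃ λ i → j ≡ suc i
  Ends-positive (stop _)   = _ , refl
  Ends-positive (pass _ _) = _ , refl

  module _ (s u : Fin (suc b)) where

    private
      g : Vec (Fin (suc b)) b
      g = map (fill s u) c

      step : ∀ {z x k} → lookup c z ≡ x → Reaches g (fill s u x) k → Reaches g (suc z) (suc k)
      step {z} {x} eq p = next (subst (λ t → Reaches g t _)
        (sym (trans (lookup-map z (fill s u) c) (cong (fill s u) eq))) p)

      unstep : ∀ {z x k} → lookup c z ≡ x → Reaches g (suc z) k →
               ∃ λ i → Reaches g (fill s u x) i
      unstep {z} eq (next p) = _ , subst (λ t → Reaches g t _)
        (trans (lookup-map z (fill s u) c) (cong (fill s u) eq)) p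

    Ends-ground : ∀ {t j} → Ends c t nothing j → Reaches g t j
    Ends-ground ground      = done
    Ends-ground (pass eq e) = step eq (Ends-ground e)

    Ends-reaches : ∀ {t k j i} → Ends c t (just k) j →
                   Reaches g (fill s u (inj₂ k)) i → Reaches g t (j ℕ.+ i)
    Ends-reaches (stop eq)   p = step eq p
    Ends-reaches (pass eq e) p = step eq (Ends-reaches e p)

    Ends-reached : ∀ {t k j i} → Ends c t (just k) j → Reaches g t i →
                   ∃ λ i′ → Reaches g (fill s u (inj₂ k)) i′
    Ends-reached (stop eq)   p = unstep eq p
    Ends-reached (pass eq e) p = Ends-reached e (proj₂ (unstep eq p))

    -- The walk is cut at the first marked vertex.
    Reaches⇒Ends : ∀ {t i} → Reaches g t i → ∃₂ (Ends c t)
    Reaches⇒Ends done = _ , _ , ground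
    Reaches⇒Ends {suc z} (next p) with lookup c z in eq | lookup-map z (fill s u) c
    ... | inj₂ k | _ = _ , _ , stop eq
    ... | inj₁ t | eq′ with Reaches⇒Ends p
    ...   | e , j , q = e , suc j , pass eq (subst (λ t → Ends c t e j) eq′ q)

    Acyclic-fill : (∀ t → ∃₂ (Ends c t)) → ∃ (Reaches g s) → ∃ (Reaches g u) → Acyclic g
    Acyclic-fill ends ps pu t with ends t
    ... | nothing     , _ , e = _ , Ends-ground e
    ... | just false  , _ , e = _ , Ends-reaches e (proj₂ ps)
    ... | just true   , _ , e = _ , Ends-reaches e (proj₂ pu)

-- Whether fill s u is acyclic, if s leads to α and u leads to β, where `nothing` is the ground.
verdict : Maybe Bool → Maybe Bool → Bool
verdict nothing     nothing      = true
verdict nothing     (just false) = true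
verdict (just true) nothing      = true
verdict _           _            = false

module _ {b} {c : Vec (Fin (suc b) ⊎ Bool) b} (ends : ∀ t → ∃₂ (Ends c t)) where

  -- A cycle must pass through a mark: s returns to its own mark, u to its own, or each leads to the
  -- mark of the other. In every case one vertex would reach the ground in two different numbers of
  -- steps, which `loop` refutes.
  acyclic?-verdict : ∀ {s u α β i j} → Ends c s α i → Ends c u β j →
                     does (acyclic? (map (fill s u) c)) ≡ verdict α β
  acyclic?-verdict {s} {u} = go
    where
    g = map (fill s u) c

    yes! : ∃ (Reaches g s) → ∃ (Reaches g u) → does (acyclic? g) ≡ true
    yes! p q = dec-true (acyclic? g) (Acyclic-fill s u ends p q)

    loop : ∀ {t k} → Reaches g t k → ∀ {i} j → Reaches g t (i ℕ.+ k) → i ≡ suc j → ⊥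
    loop {k = k} p j q refl = ℕ.m≢1+n+m k (Reaches-functional p q)

    s↻ : ∀ {i} → Ends c s (just false) i → ¬ Acyclic g
    s↻ e acyc with acyc s | Ends-positive e
    ... | _ , p | j , eq = loop p j (Ends-reaches s u e p) eq

    u↻ : ∀ {i} → Ends c u (just true) i → ¬ Acyclic g
    u↻ e acyc with acyc u | Ends-positive e
    ... | _ , p | j , eq = loop p j (Ends-reaches s u e p) eq

    su↻ : ∀ {i j} → Ends c s (just true) i → Ends c u (just false) j → ¬ Acyclic g
    su↻ {i} e e′ acyc with acyc s | Ends-positive e
    ... | k , p | _ , refl = loop p _ (subst (Reaches g s) (sym (ℕ.+-assoc i _ k))
      (Ends-reaches s u e (Ends-reaches s u e′ p))) refl

    go : ∀ {α β i j} → Ends c s α i → Ends c u β j → does (acyclic? g) ≡ verdict α β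
    go {nothing} {nothing} e e′ = yes! (_ , Ends-ground s u e) (_ , Ends-ground s u e′)
    go {nothing} {just false} e e′ = yes! (_ , p) (_ , Ends-reaches s u e′ p)
      where p = Ends-ground s u e
    go {nothing} {just true} e e′ = dec-false (acyclic? g) (u↻ e′)
    go {just false} e e′ = dec-false (acyclic? g) (s↻ e)
    go {just true} {nothing} e e′ = yes! (_ , Ends-reaches s u e p) (_ , p)
      where p = Ends-ground s u e′
    go {just true} {just false} e e′ = dec-false (acyclic? g) (su↻ e e′)
    go {just true} {just true} e e′ = dec-false (acyclic? g) (u↻ e′)

Ends-all : ∀ {b} {c : Vec (Fin (suc b) ⊎ Bool) b} s u →
           Acyclic (map (fill s u) c) → ∀ t → ∃₂ (Ends c t)
Ends-all s u acyc t = Reaches⇒Ends s u (proj₂ (acyc t))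

-- Weighted sums over maps and the elimination of one side.

-- `+-halve` recovers an identity from its symmetrisation in a structure without subtraction.
record Weights : Set₁ where
  infixl 6 _+_
  infixl 7 _*_
  field
    Carrier : Set
    _+_ _*_ : Carrier → Carrier → Carrier
    0# 1#   : Carrier
    isCommutativeSemiring : IsCommutativeSemiring _≡_ _+_ _*_ 0# 1#
    +-halve : ∀ {x y} → x + x ≡ y + y → x ≡ y

  commutativeSemiring : CommutativeSemiring 0ℓ 0ℓ
  commutativeSemiring = record { isCommutativeSemiring = isCommutativeSemiring }

via : ∀ {a b} → Vec (Fin (suc b)) a → Fin (suc a) → Fin (suc b)
via f zero    = zero
via f (suc i) = lookup f i

-- Both composites consist of double steps of the same bipartite map. After a single step on one
-- side, a walk of one composite becomes a walk of the other.
Acyclic-commutes : ∀ {a b} (f : Vec (Fin (suc b)) a) (g : Vec (Fin (suc a)) b) →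
                   Acyclic (map (via f) g) → Acyclic (map (via g) f)
Acyclic-commutes f g acyc zero    = _ , done
Acyclic-commutes f g acyc (suc i) = enter i (push (proj₂ (acyc (lookup f i))))
  where
  enter : ∀ i → ∃ (Reaches (map (via g) f) (via g (lookup f i))) → ∃ (Reaches (map (via g) f) (suc i))
  enter i (k , p) = suc k , next (subst (λ t → Reaches (map (via g) f) t k) (sym (lookup-map i (via g) f)) p)

  push : ∀ {t k} → Reaches (map (via f) g) t k → ∃ (Reaches (map (via g) f) (via g t))
  push done = _ , done
  push (next {z} p) with lookup g z | lookup-map z (via f) g
  ... | zero  | _  = _ , done
  ... | suc i | eq = enter i (push (subst (λ t → Reaches (map (via f) g) t _) eq p))

module WeightedSums (𝕎 : Weights) where
  open Weights 𝕎
  open CommutativeSemiring commutativeSemiring public using (semiring; +-comm; +-assoc; *-comm; *-assoc; distribˡ; distribʳ; *-identityˡ; *-identityʳ; zeroʳ)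
  private
    module S = SemiringSum semiring
  open ≡-Reasoning

  -- Abstract, so that the length and the summand can be inferred from a sum.
  abstract
    sum : ∀ {n} → (Fin n → Carrier) → Carrier
    sum = S.sum

    sum-empty : ∀ (f : Fin 0 → Carrier) → sum f ≡ 0#
    sum-empty f = refl

    sum-suc : ∀ {n} (f : Fin (suc n) → Carrier) → sum f ≡ f zero + sum (f ∘ suc)
    sum-suc f = refl

    sum-cong : ∀ {n} {f g : Fin n → Carrier} → (∀ i → f i ≡ g i) → sum f ≡ sum g
    sum-cong = S.sum-cong-≗

    sum-+ : ∀ {n} (f g : Fin n → Carrier) → sum (λ i → f i + g i) ≡ sum f + sum g
    sum-+ = S.∑-distrib-+

    sum-comm : ∀ {m n} (f : Fin m → Fin n → Carrier) →
               sum (λ i → sum λ j → f i j) ≡ sum (λ j → sum λ i → f i j)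
    sum-comm = S.∑-comm

    *-sum : ∀ {n} x (f : Fin n → Carrier) → x * sum f ≡ sum (λ i → x * f i)
    *-sum = S.*-distribˡ-sum

    sum-* : ∀ {n} (f : Fin n → Carrier) x → sum f * x ≡ sum (λ i → f i * x)
    sum-* f x = S.*-distribʳ-sum x f

  infixr 8 _^_
  _^_ : Carrier → ℕ → Carrier
  x ^ zero  = 1#
  x ^ suc n = x * x ^ n

  *-swap : ∀ x y z → x * (y * z) ≡ y * (x * z)
  *-swap x y z = trans (sym (*-assoc x y z)) (trans (cong (_* z) (*-comm x y)) (*-assoc y x z))

  pairSum : ∀ {k} → (Fin k → Carrier) → (Fin k → Fin k → Carrier) → Carrier
  pairSum w φ = sum λ s → sum λ u → w s * (w u * φ s u)

  module _ {k} (w : Fin k → Carrier) where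

    pairSum-cong : ∀ {φ ψ} → (∀ s u → φ s u ≡ ψ s u) → pairSum w φ ≡ pairSum w ψ
    pairSum-cong eq = sum-cong λ s → sum-cong λ u → cong (λ x → w s * (w u * x)) (eq s u)

    pairSum-flip : ∀ φ → pairSum w φ ≡ pairSum w (flip φ)
    pairSum-flip φ = trans (sum-comm _) (sum-cong λ s → sum-cong λ u → *-swap (w u) (w s) _)

    pairSum-+ : ∀ φ ψ → pairSum w φ + pairSum w ψ ≡ pairSum w (λ s u → φ s u + ψ s u)
    pairSum-+ φ ψ = trans (sym (sum-+ _ _)) (sum-cong λ s →
      trans (sym (sum-+ _ _)) (sum-cong λ u →
      trans (sym (distribˡ (w s) _ _)) (cong (w s *_) (sym (distribˡ (w u) _ _)))))

    -- The weight of a pair is symmetric, so twice the double sum of φ s u is the sum of φ s u + φ u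
    -- s, which the hypothesis turns into twice the diagonal sum.
    pairSum-diagonal : ∀ φ → (∀ s u → φ s u + φ u s ≡ φ s s + φ u u) →
                       pairSum w φ ≡ pairSum w (λ s u → φ s s)
    pairSum-diagonal φ exch = +-halve (begin
      pairSum w φ + pairSum w φ                                ≡⟨ cong (pairSum w φ +_) (pairSum-flip φ) ⟩
      pairSum w φ + pairSum w (flip φ)                         ≡⟨ pairSum-+ φ (flip φ) ⟩
      pairSum w (λ s u → φ s u + φ u s)                        ≡⟨ pairSum-cong exch ⟩
      pairSum w (λ s u → φ s s + φ u u)                        ≡⟨ pairSum-+ (λ s u → φ s s) (λ s u → φ u u) ⟨
      pairSum w (λ s u → φ s s) + pairSum w (λ s u → φ u u)    ≡⟨ cong (pairSum w (λ s u → φ s s) +_) (pairSum-flip (λ s u → φ u u)) ⟩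
      pairSum w (λ s u → φ s s) + pairSum w (λ s u → φ s s)    ∎)

  -- The sum over all maps of the product of the weights times h, kept in nested form so that
  -- induction can peel off one vertex; `wsum-product` recovers the flat form.
  wsum : ∀ {n k} → (Fin n → Fin k → Carrier) → (Vec (Fin k) n → Carrier) → Carrier
  wsum {zero}  W h = h []
  wsum {suc n} W h = sum λ t → W zero t * wsum (W ∘ suc) (h ∘ (t ∷_))

  wsum-cong : ∀ {n k} (W : Fin n → Fin k → Carrier) {h h′} → (∀ v → h v ≡ h′ v) → wsum W h ≡ wsum W h′
  wsum-cong {zero}  W eq = eq []
  wsum-cong {suc n} W eq = sum-cong λ t → cong (W zero t *_) (wsum-cong (W ∘ suc) (eq ∘ (t ∷_)))

  wsum-weights-cong : ∀ {n k} (W W′ : Fin n → Fin k → Carrier) → (∀ i t → W i t ≡ W′ i t) →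
                      ∀ h → wsum W h ≡ wsum W′ h
  wsum-weights-cong {zero}  W W′ eq h = refl
  wsum-weights-cong {suc n} W W′ eq h = sum-cong λ t →
    cong₂ _*_ (eq zero t) (wsum-weights-cong (W ∘ suc) (W′ ∘ suc) (eq ∘ suc) (h ∘ (t ∷_)))

  wsum-* : ∀ {n k} (W : Fin n → Fin k → Carrier) x h → x * wsum W h ≡ wsum W (λ v → x * h v)
  wsum-* {zero}  W x h = refl
  wsum-* {suc n} {k} W x h = trans (*-sum x _) (sum-cong λ t →
    trans (*-swap x _ _) (cong (W zero t *_) (wsum-* (W ∘ suc) x _)))

  wsum-sum : ∀ {n k l} (W : Fin n → Fin k → Carrier) (φ : Fin l → Vec (Fin k) n → Carrier) →
             wsum W (λ v → sum λ t → φ t v) ≡ sum λ t → wsum W (φ t)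
  wsum-sum {zero}  W φ = refl
  wsum-sum {suc n} {k} {l} W φ = begin
    sum (λ t → W zero t * wsum (W ∘ suc) (λ v → sum λ s → φ s (t ∷ v)))
      ≡⟨ sum-cong (λ t → trans (cong (W zero t *_) (wsum-sum (W ∘ suc) (λ s → φ s ∘ (t ∷_)))) (*-sum _ _)) ⟩
    sum (λ t → sum λ s → W zero t * wsum (W ∘ suc) (φ s ∘ (t ∷_)))
      ≡⟨ sum-comm _ ⟩
    sum (λ s → wsum W (φ s)) ∎

  wsum-comm : ∀ {n k n′ k′} (W : Fin n → Fin k → Carrier) (W′ : Fin n′ → Fin k′ → Carrier)
              (φ : Vec (Fin k) n → Vec (Fin k′) n′ → Carrier) →
              wsum W (λ v → wsum W′ (φ v)) ≡ wsum W′ (λ v′ → wsum W (λ v → φ v v′))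
  wsum-comm {zero} W W′ φ = refl
  wsum-comm {suc n} W W′ φ = begin
    sum (λ t → W zero t * wsum (W ∘ suc) (λ v → wsum W′ (φ (t ∷ v))))
      ≡⟨ sum-cong (λ t → trans (cong (W zero t *_) (wsum-comm (W ∘ suc) W′ (φ ∘ (t ∷_)))) (wsum-* W′ _ _)) ⟩
    sum (λ t → wsum W′ (λ v′ → W zero t * wsum (W ∘ suc) (λ v → φ (t ∷ v) v′)))
      ≡⟨ wsum-sum W′ _ ⟨
    wsum W′ (λ v′ → wsum W (λ v → φ v v′)) ∎

  module _ {k : ℕ} (x : Carrier) where

    wsum-const : ∀ {n} (W : Fin n → Fin k → Carrier) → (∀ i → sum (W i) ≡ x) →
                 ∀ y → wsum W (λ _ → y) ≡ x ^ n * y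
    wsum-const {zero}  W tot y = sym (*-identityˡ y)
    wsum-const {suc n} W tot y = begin
      sum (λ t → W zero t * wsum (W ∘ suc) (λ _ → y)) ≡⟨ sum-* _ _ ⟨
      sum (W zero) * wsum (W ∘ suc) (λ _ → y)         ≡⟨ cong₂ _*_ (tot zero) (wsum-const (W ∘ suc) (tot ∘ suc) y) ⟩
      x * (x ^ n * y)                                 ≡⟨ *-assoc _ _ _ ⟨
      x ^ suc n * y                                   ∎

    -- After the update the old value at i no longer occurs, so its weights add up to the factor x.
    resample : ∀ {n} (W : Fin n → Fin k → Carrier) i → sum (W i) ≡ x → ∀ φ →
               x * wsum W φ ≡ wsum W (λ v → sum λ s → W i s * φ (v [ i ]≔ s))
    resample {suc n} W zero tot φ = begin
      x * wsum W φ
        ≡⟨ cong (_* wsum W φ) (sym tot) ⟩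
      sum (W zero) * wsum W φ
        ≡⟨ sum-* _ _ ⟩
      sum (λ t → W zero t * wsum W φ)
        ≡⟨ sum-cong (λ t → cong (W zero t *_) (trans (sum-cong (λ s → wsum-* (W ∘ suc) _ _)) (sym (wsum-sum (W ∘ suc) _)))) ⟩
      wsum W (λ v → sum λ s → W zero s * φ (v [ zero ]≔ s)) ∎
    resample {suc n} W (suc i) tot φ = trans (*-sum x _) (sum-cong λ t →
      trans (*-swap x _ _) (cong (W zero t *_) (resample (W ∘ suc) i tot (φ ∘ (t ∷_)))))

  -- Formulated for vectors of any length, because the induction in `eliminate` fixes leading
  -- coordinates, and acyclicity makes no sense for the shorter vector that is left.
  Exchanging : ∀ {n} {D : Set} → (Vec D n → Carrier) → Set
  Exchanging {n} {D} h = ∀ (c : Vec (D ⊎ Bool) n) s u →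
    h (map (fill s u) c) + h (map (fill u s) c) ≡ h (map (fill s s) c) + h (map (fill u u) c)

  Exchanging-∷ : ∀ {n} {D : Set} (h : Vec D (suc n) → Carrier) → Exchanging h → ∀ t → Exchanging (h ∘ (t ∷_))
  Exchanging-∷ h exch t c = exch (inj₁ t ∷ c)

  module Elimination {a b} (x : Carrier) (cancel : ∀ {y z} → x * y ≡ x * z → y ≡ z)
                     (wA : Fin a → Fin (suc b) → Carrier) (tot : ∀ i → sum (wA i) ≡ x) where

    private
      D : Set
      D = Fin (suc b)

    -- Up to the factor x, the value of f at i may be replaced by an independent sample u.
    decouple : ∀ {n} (h : Vec D (suc n) → Carrier) → Exchanging h → ∀ i (g : Vec (Fin (suc a)) n) →
               x * wsum wA (λ f → h (lookup f i ∷ map (via f) g)) ≡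
               wsum wA (λ f → sum λ u → wA i u * h (u ∷ map (via f) g))
    -- A second factor x allows the row of i to be summed twice, for the value s of f at i and for
    -- an independent u. The left side becomes the diagonal double sum and the right side the full
    -- one.
    decouple {n} h exch i g = cancel (begin
      x * (x * wsum wA (λ f → h (lookup f i ∷ map (via f) g)))
        ≡⟨ cong (x *_) (resample x wA i (tot i) _) ⟩
      x * wsum wA (λ f → sum λ s → w s * h (lookup (f [ i ]≔ s) i ∷ map (via (f [ i ]≔ s)) g))
        ≡⟨ wsum-* wA x _ ⟩
      wsum wA (λ f → x * sum λ s → w s * h (lookup (f [ i ]≔ s) i ∷ map (via (f [ i ]≔ s)) g))
        ≡⟨ wsum-cong wA (λ f → trans (*-sum x _) (sum-cong λ s → diag f s)) ⟩
      wsum wA (λ f → pairSum w (λ s u → κ f s s))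
        ≡⟨ wsum-cong wA (λ f → pairSum-diagonal w (κ f) (κ-exch f)) ⟨
      wsum wA (λ f → pairSum w (κ f))
        ≡⟨ wsum-cong wA (λ f → sum-cong λ s → *-sum _ _) ⟨
      wsum wA (λ f → sum λ s → w s * sum λ u → w u * κ f s u)
        ≡⟨ resample x wA i (tot i) _ ⟨
      x * wsum wA (λ f → sum λ u → w u * h (u ∷ map (via f) g)) ∎)
      where
      w = wA i

      κ : Vec D a → D → D → Carrier
      κ f s u = h (u ∷ map (via (f [ i ]≔ s)) g)

      -- Every vertex of g that uses i receives the mark false, to be filled by s; the head
      -- coordinate receives true, to be filled by u.
      mark : Vec D a → Fin (suc a) → D ⊎ Bool
      mark f zero    = inj₁ zero
      mark f (suc j) with j Fin.≟ i
      ... | yes _ = inj₂ false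
      ... | no  _ = inj₁ (lookup f j)

      fill-mark : ∀ f s u t → via (f [ i ]≔ s) t ≡ fill s u (mark f t)
      fill-mark f s u zero    = refl
      fill-mark f s u (suc j) with j Fin.≟ i
      ... | yes refl = lookup∘update j f s
      ... | no  j≢i  = lookup∘update′ j≢i f s

      κ-fill : ∀ f s u → κ f s u ≡ h (map (fill s u) (inj₂ true ∷ map (mark f) g))
      κ-fill f s u = cong (λ v → h (u ∷ v)) (trans (map-cong (fill-mark f s u) g) (map-∘ (fill s u) (mark f) g))

      κ-exch : ∀ f s u → κ f s u + κ f u s ≡ κ f s s + κ f u u
      κ-exch f s u = begin
        κ f s u + κ f u s ≡⟨ cong₂ _+_ (κ-fill f s u) (κ-fill f u s) ⟩
        _                 ≡⟨ exch (inj₂ true ∷ map (mark f) g) s u ⟩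
        _                 ≡⟨ cong₂ _+_ (κ-fill f s s) (κ-fill f u u) ⟨
        κ f s s + κ f u u ∎

      diag : ∀ f s → x * (w s * h (lookup (f [ i ]≔ s) i ∷ map (via (f [ i ]≔ s)) g)) ≡
                     sum λ u → w s * (w u * κ f s s)
      diag f s = begin
        x * (w s * h (lookup (f [ i ]≔ s) i ∷ map (via (f [ i ]≔ s)) g))
          ≡⟨ cong (λ t → x * (w s * h (t ∷ map (via (f [ i ]≔ s)) g))) (lookup∘update i f s) ⟩
        x * (w s * κ f s s)                   ≡⟨ *-swap x (w s) _ ⟩
        w s * (x * κ f s s)                   ≡⟨ cong (λ y → w s * (y * κ f s s)) (tot i) ⟨
        w s * (sum w * κ f s s)               ≡⟨ cong (w s *_) (sum-* w _) ⟩
        w s * sum (λ u → w u * κ f s s)       ≡⟨ *-sum (w s) _ ⟩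
        sum (λ u → w s * (w u * κ f s s))     ∎

    -- Each vertex of B pays one factor x. A path through A spends it on decoupling; an edge
    -- straight to the ground uses no vertex of A, so there the factor stays.
    bypass : ∀ {n} → (Fin n → Fin (suc a) → Carrier) → Fin n → D → Carrier
    bypass wB y zero    = x * wB y zero + sum λ i → wB y (suc i) * wA i zero
    bypass wB y (suc z) = sum λ i → wB y (suc i) * wA i (suc z)

    -- Induction on the vertices of B, decoupling one at a time from f. When none is left, the
    -- summand no longer depends on f and the sum over f contributes x ^ a.
    eliminate : ∀ {n} (wB : Fin n → Fin (suc a) → Carrier) (h : Vec D n → Carrier) → Exchanging h →
                x ^ n * wsum wA (λ f → wsum wB (λ g → h (map (via f) g))) ≡ x ^ a * wsum (bypass wB) h
    eliminate {zero}  wB h exch = trans (*-identityˡ _) (wsum-const x wA tot _)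
    eliminate {suc n} wB h exch = begin
      x ^ suc n * wsum wA (λ f → wsum wB (λ g → h (map (via f) g)))
        ≡⟨ trans (*-assoc _ _ _) (*-swap _ _ _) ⟩
      x ^ n * (x * wsum wA (λ f → wsum wB (λ g → h (map (via f) g))))
        ≡⟨ cong (λ y → x ^ n * (x * y)) (trans (wsum-sum wA _) (sum-cong λ t → sym (wsum-* wA _ _))) ⟩
      x ^ n * (x * sum (λ t → wB zero t * coupled t))
        ≡⟨ cong (x ^ n *_) (trans (*-sum x (λ t → wB zero t * coupled t)) (trans (sum-suc _) (cong₂ _+_ (sym (*-assoc _ _ _))
             (sum-cong λ i → trans (*-swap _ _ _) (trans (cong (wB zero (suc i) *_) (coupled-suc i))
               (*-sum (wB zero (suc i)) (λ u → wA i u * free u))))))) ⟩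
      x ^ n * (x * wB zero zero * free zero + sum (λ i → sum λ u → wB zero (suc i) * (wA i u * free u)))
        ≡⟨ cong (λ y → x ^ n * (x * wB zero zero * free zero + y)) (trans (sum-comm _)
             (sum-cong λ u → trans (sum-cong λ i → sym (*-assoc (wB zero (suc i)) _ _)) (sym (sum-* _ (free u))))) ⟩
      x ^ n * (x * wB zero zero * free zero + sum (λ u → through u * free u))
        ≡⟨ cong (λ y → x ^ n * (x * wB zero zero * free zero + y)) (sum-suc _) ⟩
      x ^ n * (x * wB zero zero * free zero + (through zero * free zero + sum (λ z → through (suc z) * free (suc z))))
        ≡⟨ cong (x ^ n *_) (trans (sym (+-assoc _ _ _)) (trans (cong (_+ sum (λ z → through (suc z) * free (suc z))) (sym (distribʳ (free zero) _ _))) (sym (sum-suc _)))) ⟩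
      x ^ n * sum (λ u → bypass wB zero u * free u)
        ≡⟨ trans (*-sum _ _) (sum-cong λ u → trans (*-swap _ _ _)
             (cong (bypass wB zero u *_) (eliminate (wB ∘ suc) (h ∘ (u ∷_)) (Exchanging-∷ h exch u)))) ⟩
      sum (λ u → bypass wB zero u * (x ^ a * wsum (bypass (wB ∘ suc)) (h ∘ (u ∷_))))
        ≡⟨ trans (sum-cong λ u → *-swap (bypass wB zero u) _ _) (sym (*-sum _ _)) ⟩
      x ^ a * sum (λ u → bypass wB zero u * wsum (bypass (wB ∘ suc)) (h ∘ (u ∷_)))
        ≡⟨ cong (x ^ a *_) (sum-cong λ u → cong (bypass wB zero u *_) (wsum-weights-cong (bypass (wB ∘ suc)) (bypass wB ∘ suc) (λ { y zero → refl ; y (suc z) → refl }) (h ∘ (u ∷_)))) ⟩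
      x ^ a * wsum (bypass wB) h ∎
      where
      coupled : Fin (suc a) → Carrier
      coupled t = wsum wA (λ f → wsum (wB ∘ suc) (λ g → h (via f t ∷ map (via f) g)))

      free : D → Carrier
      free u = wsum wA (λ f → wsum (wB ∘ suc) (λ g → h (u ∷ map (via f) g)))

      through : D → Carrier
      through u = sum λ i → wB zero (suc i) * wA i u

      coupled-suc : ∀ i → x * coupled (suc i) ≡ sum λ u → wA i u * free u
      coupled-suc i = begin
        x * coupled (suc i)
          ≡⟨ cong (x *_) (wsum-comm wA (wB ∘ suc) _) ⟩
        x * wsum (wB ∘ suc) (λ g → wsum wA (λ f → h (lookup f i ∷ map (via f) g)))
          ≡⟨ trans (wsum-* (wB ∘ suc) x _) (wsum-cong (wB ∘ suc) λ g → decouple h exch i g) ⟩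
        wsum (wB ∘ suc) (λ g → wsum wA (λ f → sum λ u → wA i u * h (u ∷ map (via f) g)))
          ≡⟨ trans (wsum-cong (wB ∘ suc) (λ g → wsum-sum wA _)) (wsum-sum (wB ∘ suc) _) ⟩
        sum (λ u → wsum (wB ∘ suc) (λ g → wsum wA (λ f → wA i u * h (u ∷ map (via f) g))))
          ≡⟨ sum-cong (λ u → trans (wsum-cong (wB ∘ suc) (λ g → sym (wsum-* wA _ _)))
               (trans (sym (wsum-* (wB ∘ suc) _ _)) (cong (wA i u *_) (wsum-comm (wB ∘ suc) wA _)))) ⟩
        sum (λ u → wA i u * free u) ∎

  indicator : Bool → Carrier
  indicator true  = 1#
  indicator false = 0#

  forest : ∀ {b} → Vec (Fin (suc b)) b → Carrier
  forest v = indicator (does (acyclic? v))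

  -- Each side is the number of `nothing` among α and β.
  verdict-exchange : ∀ α β → indicator (verdict α β) + indicator (verdict β α) ≡
                             indicator (verdict α α) + indicator (verdict β β)
  verdict-exchange nothing      nothing      = refl
  verdict-exchange nothing      (just false) = refl
  verdict-exchange nothing      (just true)  = +-comm _ _
  verdict-exchange (just false) nothing      = refl
  verdict-exchange (just true)  nothing      = +-comm _ _
  verdict-exchange (just false) (just false) = refl
  verdict-exchange (just false) (just true)  = refl
  verdict-exchange (just true)  (just false) = refl
  verdict-exchange (just true)  (just true)  = refl

  -- One acyclic filling already shows that every vertex leads to the ground or to a mark, and then
  -- all four indicators are read off from `verdict`. If no filling is acyclic, all four vanish.
  forest-exchange : ∀ {b} → Exchanging (forest {b})
  forest-exchange {b} c s u = go (acyclic? _) (acyclic? _) (acyclic? _) (acyclic? _) refl refl refl refl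
    where
    by-ends : (∀ t → ∃₂ (Ends c t)) → forest (map (fill s u) c) + forest (map (fill u s) c) ≡
                                      forest (map (fill s s) c) + forest (map (fill u u) c)
    by-ends ends = begin
      _ ≡⟨ cong₂ _+_ (at s u) (at u s) ⟩
      _ ≡⟨ verdict-exchange (proj₁ (ends s)) (proj₁ (ends u)) ⟩
      _ ≡⟨ cong₂ _+_ (at s s) (at u u) ⟨
      _ ∎
      where
      at : ∀ p q → forest (map (fill p q) c) ≡ indicator (verdict (proj₁ (ends p)) (proj₁ (ends q)))
      at p q = cong indicator (acyclic?-verdict ends (proj₂ (proj₂ (ends p))) (proj₂ (proj₂ (ends q))))

    go : (d₁ : Dec (Acyclic (map (fill s u) c))) (d₂ : Dec (Acyclic (map (fill u s) c)))
         (d₃ : Dec (Acyclic (map (fill s s) c))) (d₄ : Dec (Acyclic (map (fill u u) c))) →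
         forest (map (fill s u) c) ≡ indicator (does d₁) → forest (map (fill u s) c) ≡ indicator (does d₂) →
         forest (map (fill s s) c) ≡ indicator (does d₃) → forest (map (fill u u) c) ≡ indicator (does d₄) →
         forest (map (fill s u) c) + forest (map (fill u s) c) ≡
         forest (map (fill s s) c) + forest (map (fill u u) c)
    go (yes p) _ _ _ _ _ _ _ = by-ends (Ends-all s u p)
    go (no _) (yes p) _ _ _ _ _ _ = by-ends (Ends-all u s p)
    go (no _) (no _) (yes p) _ _ _ _ _ = by-ends (Ends-all s s p)
    go (no _) (no _) (no _) (yes p) _ _ _ _ = by-ends (Ends-all u u p)
    go (no _) (no _) (no _) (no _) e₁ e₂ e₃ e₄ =
      trans (cong₂ _+_ e₁ e₂) (sym (cong₂ _+_ e₃ e₄))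

  module Bipartite {a b} (x y : Carrier)
    (cancel-x : ∀ {u v} → x * u ≡ x * v → u ≡ v) (cancel-y : ∀ {u v} → y * u ≡ y * v → u ≡ v)
    (wA : Fin a → Fin (suc b) → Carrier) (totA : ∀ i → sum (wA i) ≡ x)
    (wB : Fin b → Fin (suc a) → Carrier) (totB : ∀ j → sum (wB j) ≡ y) where

    private
      module A = Elimination x cancel-x wA totA
      module B = Elimination y cancel-y wB totB

    forests-A forests-B : Carrier
    forests-A = wsum (B.bypass wA) forest
    forests-B = wsum (A.bypass wB) forest

    forest-commutes : ∀ (f : Vec (Fin (suc b)) a) (g : Vec (Fin (suc a)) b) →
                      forest (map (via f) g) ≡ forest (map (via g) f)
    forest-commutes f g = cong indicator (does-⇔
      (mk⇔ (Acyclic-commutes f g) (Acyclic-commutes g f)) (acyclic? _) (acyclic? _))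

    -- Both eliminations start from the same sum over pairs f, g, because the two composites are
    -- acyclic together.
    forests-ratio : x ^ b * (y ^ b * forests-A) ≡ y ^ a * (x ^ a * forests-B)
    forests-ratio = begin
      x ^ b * (y ^ b * forests-A)
        ≡⟨ cong (x ^ b *_) (B.eliminate wA forest forest-exchange) ⟨
      x ^ b * (y ^ a * wsum wB (λ g → wsum wA (λ f → forest (map (via g) f))))
        ≡⟨ *-swap _ _ _ ⟩
      y ^ a * (x ^ b * wsum wB (λ g → wsum wA (λ f → forest (map (via g) f))))
        ≡⟨ cong (λ u → y ^ a * (x ^ b * u)) (trans (wsum-comm wB wA _)
             (wsum-cong wA λ f → wsum-cong wB λ g → sym (forest-commutes f g))) ⟩
      y ^ a * (x ^ b * wsum wA (λ f → wsum wB (λ g → forest (map (via f) g))))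
        ≡⟨ cong (y ^ a *_) (A.eliminate wB forest forest-exchange) ⟩
      y ^ a * (x ^ a * forests-B) ∎

-- Natural numbers and dual numbers as weights.

ℕ-weights : Weights
ℕ-weights = record
  { isCommutativeSemiring = ℕ.+-*-isCommutativeSemiring
  ; +-halve = λ {x} {y} eq → ℕ.*-cancelˡ-≡ x y 2 (trans (double x) (trans eq (sym (double y))))
  }
  where
  double : ∀ x → 2 ℕ.* x ≡ x ℕ.+ x
  double = solve-∀

-- The pair (a , b) stands for a + b ε with ε² = 0.
Dual : Set
Dual = ℕ × ℕ

infixl 6 _⊕_
infixl 7 _⊗_
_⊕_ _⊗_ : Dual → Dual → Dual
(a , b) ⊕ (c , d) = a ℕ.+ c , b ℕ.+ d
(a , b) ⊗ (c , d) = a ℕ.* c , a ℕ.* d ℕ.+ b ℕ.* c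

dual-weights : Weights
dual-weights = record
  { Carrier = Dual ; _+_ = _⊕_ ; _*_ = _⊗_ ; 0# = 0 , 0 ; 1# = 1 , 0
  ; isCommutativeSemiring = isCommutativeSemiringˡ record
    { +-isCommutativeMonoid = record
      { isMonoid = record
        { isSemigroup = record
          { isMagma = record { isEquivalence = isEquivalence ; ∙-cong = cong₂ _⊕_ }
          ; assoc = λ (a , a′) (b , b′) (c , c′) → cong₂ _,_ (ℕ.+-assoc a b c) (ℕ.+-assoc a′ b′ c′)
          }
        ; identity = (λ _ → refl) , λ (a , a′) → cong₂ _,_ (ℕ.+-identityʳ a) (ℕ.+-identityʳ a′)
        }
      ; comm = λ (a , a′) (b , b′) → cong₂ _,_ (ℕ.+-comm a b) (ℕ.+-comm a′ b′)
      }
    ; *-isCommutativeMonoid = record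
      { isMonoid = record
        { isSemigroup = record
          { isMagma = record { isEquivalence = isEquivalence ; ∙-cong = cong₂ _⊗_ }
          ; assoc = λ (a , a′) (b , b′) (c , c′) → cong₂ _,_ (ℕ.*-assoc a b c) (assoc′ a a′ b b′ c c′)
          }
        ; identity = (λ (a , a′) → cong₂ _,_ (ℕ.*-identityˡ a) (idˡ a a′))
                   , (λ (a , a′) → cong₂ _,_ (ℕ.*-identityʳ a) (idʳ a a′))
        }
      ; comm = λ (a , a′) (b , b′) → cong₂ _,_ (ℕ.*-comm a b) (comm′ a a′ b b′)
      }
    ; distribʳ = λ (a , a′) (b , b′) (c , c′) → cong₂ _,_ (ℕ.*-distribʳ-+ a b c) (distrib′ a a′ b b′ c c′)
    ; zeroˡ = λ _ → refl
    }
  ; +-halve = λ eq → cong₂ _,_ (Weights.+-halve ℕ-weights (cong proj₁ eq)) (Weights.+-halve ℕ-weights (cong proj₂ eq))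
  }
  where
  assoc′ : ∀ a a′ b b′ c c′ → a ℕ.* b ℕ.* c′ ℕ.+ (a ℕ.* b′ ℕ.+ a′ ℕ.* b) ℕ.* c ≡
                              a ℕ.* (b ℕ.* c′ ℕ.+ b′ ℕ.* c) ℕ.+ a′ ℕ.* (b ℕ.* c)
  assoc′ = solve-∀
  idˡ : ∀ a a′ → 1 ℕ.* a′ ℕ.+ 0 ℕ.* a ≡ a′
  idˡ = solve-∀
  idʳ : ∀ a a′ → a ℕ.* 0 ℕ.+ a′ ℕ.* 1 ≡ a′
  idʳ = solve-∀
  comm′ : ∀ a a′ b b′ → a ℕ.* b′ ℕ.+ a′ ℕ.* b ≡ b ℕ.* a′ ℕ.+ b′ ℕ.* a
  comm′ = solve-∀
  distrib′ : ∀ a a′ b b′ c c′ → (b ℕ.+ c) ℕ.* a′ ℕ.+ (b′ ℕ.+ c′) ℕ.* a ≡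
                                (b ℕ.* a′ ℕ.+ b′ ℕ.* a) ℕ.+ (c ℕ.* a′ ℕ.+ c′ ℕ.* a)
  distrib′ = solve-∀

module ℕΣ = WeightedSums ℕ-weights
module 𝔻Σ = WeightedSums dual-weights

open ℕΣ public using (sum; indicator)

countV : ∀ {n k} → (Vec (Fin k) n → Bool) → ℕ
countV {zero}  P = indicator (P [])
countV {suc n} P = sum λ t → countV (P ∘ (t ∷_))

sum-0 : ∀ {n} (f : Fin n → ℕ) → (∀ i → f i ≡ 0) → sum f ≡ 0
sum-0 {zero}  f eq = ℕΣ.sum-empty f
sum-0 {suc n} f eq = trans (ℕΣ.sum-suc f) (cong₂ ℕ._+_ (eq zero) (sum-0 (f ∘ suc) (eq ∘ suc)))

sum-at : ∀ {n} (f : Fin n → ℕ) i → (∀ j → j ≢ i → f j ≡ 0) → sum f ≡ f i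
sum-at {suc n} f zero eq = trans (ℕΣ.sum-suc f)
  (trans (cong (f zero ℕ.+_) (sum-0 (f ∘ suc) λ j → eq (suc j) λ ())) (ℕ.+-identityʳ _))
sum-at {suc n} f (suc i) eq = trans (ℕΣ.sum-suc f)
  (cong₂ ℕ._+_ (eq zero λ ()) (sum-at (f ∘ suc) i λ j j≢i → eq (suc j) (j≢i ∘ Fin.suc-injective)))

sum-unique : ∀ {n} (P : Fin n → Bool) → (∀ i j → P i ≡ true → P j ≡ true → i ≡ j) →
             sum (indicator ∘ P) ≡ indicator (does (any? λ i → P i Bool.≟ true))
sum-unique P uniq with any? (λ i → P i Bool.≟ true)
... | no none = sum-0 (indicator ∘ P) λ i → cong indicator (Bool.¬-not λ Pi → none (i , Pi))
... | yes (i , Pi) = trans (sum-at (indicator ∘ P) i λ j j≢i → cong indicator (Bool.¬-not λ Pj → j≢i (uniq j i Pj Pi)))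
                           (cong indicator Pi)

module _ (φ : ℕ → Dual) (φ-0 : φ 0 ≡ (0 , 0)) (φ-+ : ∀ x y → φ (x ℕ.+ y) ≡ φ x ⊕ φ y) where

  sum-homo : ∀ {n} (f : Fin n → ℕ) → 𝔻Σ.sum (φ ∘ f) ≡ φ (sum f)
  sum-homo {zero}  f = trans (𝔻Σ.sum-empty (φ ∘ f)) (sym (trans (cong φ (ℕΣ.sum-empty f)) φ-0))
  sum-homo {suc n} f = trans (𝔻Σ.sum-suc (φ ∘ f)) (trans (cong (φ (f zero) ⊕_) (sum-homo (f ∘ suc)))
    (sym (trans (cong φ (ℕΣ.sum-suc f)) (φ-+ _ _))))

  countV-homo : ∀ {n k} (P : Vec (Fin k) n → Bool) →
                𝔻Σ.wsum (λ _ _ → 1 , 0) (λ v → φ (indicator (P v))) ≡ φ (countV P)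
  countV-homo {zero}  P = refl
  countV-homo {suc n} P = trans (𝔻Σ.sum-cong λ t → trans (𝔻Σ.*-identityˡ _) (countV-homo (P ∘ (t ∷_))))
    (sum-homo λ t → countV (P ∘ (t ∷_)))

-- Rooted trees as the ε-coefficient of a forest sum.

module Products (𝕎 : Weights) where
  open Weights 𝕎
  open WeightedSums 𝕎 using (wsum; sum-cong; wsum-cong; wsum-*; *-swap; *-assoc; *-identityʳ; *-identityˡ; *-comm)

  product : ∀ {n k} → (Fin n → Fin k → Carrier) → Vec (Fin k) n → Carrier
  product W []      = 1#
  product W (t ∷ v) = W zero t * product (W ∘ suc) v

  wsum-product : ∀ {n k} (W : Fin n → Fin k → Carrier) h →
                 wsum W h ≡ wsum (λ _ _ → 1#) (λ v → product W v * h v)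
  wsum-product {zero}  W h = sym (*-identityˡ _)
  wsum-product {suc n} {k} W h = sum-cong λ t → begin
    W zero t * wsum (W ∘ suc) (h ∘ (t ∷_))
      ≡⟨ cong (W zero t *_) (wsum-product (W ∘ suc) (h ∘ (t ∷_))) ⟩
    W zero t * wsum (λ _ _ → 1#) (λ v → product (W ∘ suc) v * h (t ∷ v))
      ≡⟨ wsum-* {n} {k} (λ _ _ → 1#) (W zero t) _ ⟩
    wsum (λ _ _ → 1#) (λ v → W zero t * (product (W ∘ suc) v * h (t ∷ v)))
      ≡⟨ wsum-cong {n} {k} (λ _ _ → 1#) (λ v → sym (*-assoc (W zero t) _ _)) ⟩
    wsum (λ _ _ → 1#) (λ v → product W (t ∷ v) * h (t ∷ v))
      ≡⟨ *-identityˡ _ ⟨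
    1# * wsum (λ _ _ → 1#) (λ v → product W (t ∷ v) * h (t ∷ v)) ∎
    where open ≡-Reasoning

  product-1 : ∀ {n k} (W : Fin n → Fin k → Carrier) v → (∀ z → W z (lookup v z) ≡ 1#) → product W v ≡ 1#
  product-1 W []      eq = refl
  product-1 W (t ∷ v) eq = trans (cong₂ _*_ (eq zero) (product-1 (W ∘ suc) v (eq ∘ suc))) (*-identityˡ 1#)

  product-at : ∀ {n k} (W : Fin n → Fin k → Carrier) v i →
               (∀ z → z ≢ i → W z (lookup v z) ≡ 1#) → product W v ≡ W i (lookup v i)
  product-at W (t ∷ v) zero eq =
    trans (cong (W zero t *_) (product-1 (W ∘ suc) v λ z → eq (suc z) λ ())) (*-identityʳ _)
  product-at W (t ∷ v) (suc i) eq =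
    trans (cong₂ _*_ (eq zero λ ()) (product-at (W ∘ suc) v i λ z z≢i → eq (suc z) (z≢i ∘ Fin.suc-injective)))
          (*-identityˡ _)

  product-factor : ∀ {n k} (W : Fin n → Fin k → Carrier) v i → ∃ λ r → product W v ≡ W i (lookup v i) * r
  product-factor W (t ∷ v) zero    = _ , refl
  product-factor W (t ∷ v) (suc i) with product-factor (W ∘ suc) v i
  ... | r , eq = W zero t * r , trans (cong (W zero t *_) eq) (*-swap _ _ _)

  -- Serves to annihilate a term: with a multiple of ε at i, the product vanishes if the factor at j
  -- is zero or again a multiple of ε.
  product-factor₂ : ∀ {n k} (W : Fin n → Fin k → Carrier) v i j → i ≢ j →
                    ∃ λ r → product W v ≡ W i (lookup v i) * W j (lookup v j) * r
  product-factor₂ W (t ∷ v) zero zero i≢j = ⊥-elim (i≢j refl)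
  product-factor₂ W (t ∷ v) zero (suc j) i≢j with product-factor (W ∘ suc) v j
  ... | r , eq = r , trans (cong (W zero t *_) eq) (sym (*-assoc _ _ _))
  product-factor₂ W (t ∷ v) (suc i) zero i≢j with product-factor (W ∘ suc) v i
  ... | r , eq = r , trans (cong (W zero t *_) eq) (trans (sym (*-assoc _ _ _)) (cong (_* r) (*-comm _ _)))
  product-factor₂ W (t ∷ v) (suc i) (suc j) i≢j with product-factor₂ (W ∘ suc) v i j (i≢j ∘ cong suc)
  ... | r , eq = W zero t * r , trans (cong (W zero t *_) eq) (*-swap _ _ _)

Link : ∀ {N} → (Fin N → Fin N → Bool) → Fin N → Fin (suc N) → Set
Link adj z zero    = ⊥
Link adj z (suc y) = adj z y ≡ true

-- A rooted spanning tree encoded by its parent map. `Link` is empty at the ground, so `links` makes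
-- `root` the only vertex sent there.
record IsRootedTree {N} (adj : Fin N → Fin N → Bool) (v : Vec (Fin (suc N)) N) : Set where
  constructor rootedTree
  field
    acyclic : Acyclic v
    root    : Fin N
    root-0  : lookup v root ≡ zero
    links   : ∀ z → z ≡ root ⊎ Link adj z (lookup v z)

module _ {N} (adj : Fin N → Fin N → Bool) where

  link? : ∀ z t → Dec (Link adj z t)
  link? z zero    = no λ ()
  link? z (suc y) = adj z y Bool.≟ true

  abstract
    isRootedTree? : ∀ v → Dec (IsRootedTree adj v)
    isRootedTree? v = map′ (λ (a , r , e , l) → rootedTree a r e l) (λ (rootedTree a r e l) → a , r , e , l)
      (acyclic? v ×-dec any? λ r → lookup v r Fin.≟ zero ×-dec all? λ z → z Fin.≟ r ⊎-dec link? z (lookup v z))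

  treeCount : ℕ
  treeCount = countV (λ v → does (isRootedTree? v))

Acyclic-loopless : ∀ {N} {v : Vec (Fin (suc N)) N} → Acyclic v → ∀ z → lookup v z ≢ suc z
Acyclic-loopless {v = v} acyc z eq with acyc (suc z)
... | suc k , p@(next q) = ℕ.1+n≢n (Reaches-functional p (subst (λ t → Reaches v t k) eq q))

Reaches-root : ∀ {N} {v : Vec (Fin (suc N)) N} {z k} → Reaches v (suc z) k → ∃ λ r → lookup v r ≡ zero
Reaches-root {v = v} {z} (next p) with lookup v z in eq
... | zero  = z , eq
... | suc _ = Reaches-root p

-- `W-link` is restricted to z ≢ y because the loop weights produced by elimination are vertex
-- degrees rather than indicators; an acyclic map never uses a loop.
module TreeWeights {N} (adj : Fin (suc N) → Fin (suc N) → Bool) (d : ℕ)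
  (W : Fin (suc N) → Fin (suc (suc N)) → Dual)
  (W-ground : ∀ z → W z zero ≡ (0 , d))
  (W-link : ∀ z y → z ≢ y → W z (suc y) ≡ (indicator (adj z y) , 0)) where

  open Products dual-weights

  open ≡-Reasoning

  -- An acyclic map sends some vertex to the ground, which contributes d ε. A second such vertex
  -- gives ε² = 0 and a non-edge gives 0, so exactly the parent maps of trees survive, with all
  -- other factors 1.
  term : ∀ v → product W v ⊗ 𝔻Σ.forest v ≡ (0 , d ℕ.* indicator (does (isRootedTree? adj v)))
  term v = go (acyclic? v) (isRootedTree? adj v)
    where
    weight : ∀ {z} → Acyclic v → Link adj z (lookup v z) → W z (lookup v z) ≡ (1 , 0)
    weight {z} acyc l with lookup v z | Acyclic-loopless acyc z
    ... | suc y | loopless = trans (W-link z y (λ z≡y → loopless (cong suc (sym z≡y)))) (cong (λ b → indicator b , 0) l)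

    killed : ∀ {z} → Acyclic v → ¬ Link adj z (lookup v z) → (0 , d) ⊗ W z (lookup v z) ≡ (0 , 0)
    killed {z} acyc ¬l with lookup v z | Acyclic-loopless acyc z
    ... | zero  | _ = trans (cong ((0 , d) ⊗_) (W-ground z)) (cong (0 ,_) (ℕ.*-zeroʳ d))
    ... | suc y | loopless = trans
      (cong ((0 , d) ⊗_) (trans (W-link z y (λ z≡y → loopless (cong suc (sym z≡y))))
                                (cong (λ b → indicator b , 0) (Bool.¬-not ¬l))))
      (cong (0 ,_) (ℕ.*-zeroʳ d))

    vanishes : ¬ IsRootedTree adj v → product W v ⊗ 𝔻Σ.forest v ≡ (0 , 0) →
               product W v ⊗ 𝔻Σ.forest v ≡ (0 , d ℕ.* indicator (does (isRootedTree? adj v)))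
    vanishes ¬tree eq = trans eq (cong (0 ,_) (sym (trans
      (cong (λ b → d ℕ.* indicator b) (dec-false (isRootedTree? adj v) ¬tree)) (ℕ.*-zeroʳ d))))

    go : Dec (Acyclic v) → Dec (IsRootedTree adj v) →
         product W v ⊗ 𝔻Σ.forest v ≡ (0 , d ℕ.* indicator (does (isRootedTree? adj v)))
    go (no ¬acyc) _ = vanishes (¬acyc ∘ IsRootedTree.acyclic) (begin
      product W v ⊗ 𝔻Σ.forest v ≡⟨ cong (λ b → product W v ⊗ 𝔻Σ.indicator b) (dec-false (acyclic? v) ¬acyc) ⟩
      product W v ⊗ (0 , 0)    ≡⟨ 𝔻Σ.zeroʳ (product W v) ⟩
      (0 , 0)                  ∎)
    go (yes acyc) (yes tree) = begin
      product W v ⊗ 𝔻Σ.forest v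
        ≡⟨ cong (λ b → product W v ⊗ 𝔻Σ.indicator b) (dec-true (acyclic? v) acyc) ⟩
      product W v ⊗ (1 , 0)
        ≡⟨ 𝔻Σ.*-identityʳ (product W v) ⟩
      product W v
        ≡⟨ product-at W v root (λ z z≢r → weight acyc (nonroot z z≢r)) ⟩
      W root (lookup v root)
        ≡⟨ trans (cong (W root) root-0) (W-ground root) ⟩
      (0 , d)
        ≡⟨ cong (0 ,_) (trans (cong (λ b → d ℕ.* indicator b) (dec-true (isRootedTree? adj v) tree)) (ℕ.*-identityʳ d)) ⟨
      (0 , d ℕ.* indicator (does (isRootedTree? adj v))) ∎
      where
      open IsRootedTree tree using (root; root-0; links)
      nonroot : ∀ z → z ≢ root → Link adj z (lookup v z)
      nonroot z z≢r with links z
      ... | inj₁ z≡r = ⊥-elim (z≢r z≡r)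
      ... | inj₂ l   = l
    -- There is a first vertex to start from, as the vertex set is `Fin (suc N)`; following the map
    -- from it yields a root r.
    go (yes acyc) (no ¬tree) with Reaches-root (proj₂ (acyc (suc zero)))
    ... | r , r-0 with any? (λ z → ¬? (z Fin.≟ r) ×-dec ¬? (link? adj z (lookup v z)))
    ...   | no none = ⊥-elim (¬tree (rootedTree acyc r r-0 links))
      where
      links : ∀ z → z ≡ r ⊎ Link adj z (lookup v z)
      links z with z Fin.≟ r | link? adj z (lookup v z)
      ... | yes z≡r | _     = inj₁ z≡r
      ... | no  _   | yes l = inj₂ l
      ... | no  z≢r | no ¬l = ⊥-elim (none (z , z≢r , ¬l))
    ...   | yes (z , z≢r , ¬l) with product-factor₂ W v r z (z≢r ∘ sym)
    ...     | c , eq = vanishes ¬tree (cong (_⊗ 𝔻Σ.forest v) (begin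
      product W v                                ≡⟨ eq ⟩
      W r (lookup v r) ⊗ W z (lookup v z) ⊗ c    ≡⟨ cong (λ u → u ⊗ W z (lookup v z) ⊗ c) (trans (cong (W r) r-0) (W-ground r)) ⟩
      (0 , d) ⊗ W z (lookup v z) ⊗ c             ≡⟨ cong (_⊗ c) (killed acyc ¬l) ⟩
      (0 , 0)                                    ∎))

  forests-count-trees : 𝔻Σ.wsum W 𝔻Σ.forest ≡ (0 , d ℕ.* treeCount adj)
  forests-count-trees = begin
    𝔻Σ.wsum W 𝔻Σ.forest
      ≡⟨ wsum-product W 𝔻Σ.forest ⟩
    𝔻Σ.wsum (λ _ _ → 1 , 0) (λ v → product W v ⊗ 𝔻Σ.forest v)
      ≡⟨ 𝔻Σ.wsum-cong (λ _ _ → 1 , 0) term ⟩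
    𝔻Σ.wsum (λ _ _ → 1 , 0) (λ v → 0 , d ℕ.* indicator (does (isRootedTree? adj v)))
      ≡⟨ countV-homo (λ c → 0 , d ℕ.* c) (cong (0 ,_) (ℕ.*-zeroʳ d)) (λ x y → cong (0 ,_) (ℕ.*-distribˡ-+ d x y)) (λ v → does (isRootedTree? adj v)) ⟩
    (0 , d ℕ.* treeCount adj) ∎

-- Tree counts of the two distance-two graphs of a biregular incidence.

^-distrib-* : ∀ n a b → (a ℕ.* b) ℕ.^ n ≡ a ℕ.^ n ℕ.* b ℕ.^ n
^-distrib-* zero    a b = refl
^-distrib-* (suc n) a b = trans (cong (a ℕ.* b ℕ.*_) (^-distrib-* n a b)) (interchange a b _ _)
  where
  interchange : ∀ a b c d → a ℕ.* b ℕ.* (c ℕ.* d) ≡ a ℕ.* c ℕ.* (b ℕ.* d)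
  interchange = solve-∀

∧-true : ∀ {x y} → x ∧ y ≡ true → x ≡ true × y ≡ true
∧-true {true} {true} _ = refl , refl

does-sound : ∀ {A : Set} (d : Dec A) → does d ≡ true → A
does-sound (yes a) _ = a

module Incidence {p q : ℕ} (inc : Fin (suc p) → Fin (suc q) → Bool) (a b : ℕ) where

  -- Holds also between i and itself once something lies above i; the translation to spanning trees
  -- therefore pairs it with distinctness of the vertices.
  adjP : Fin (suc p) → Fin (suc p) → Bool
  adjP i i′ = does (any? λ j → inc i j ∧ inc i′ j Bool.≟ true)

  adjQ : Fin (suc q) → Fin (suc q) → Bool
  adjQ j j′ = does (any? λ i → inc i j ∧ inc i j′ Bool.≟ true)

  adjP-true : ∀ {i i′ j} → inc i j ≡ true → inc i′ j ≡ true → adjP i i′ ≡ true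
  adjP-true {i} {i′} {j} e e′ = dec-true (any? λ j → inc i j ∧ inc i′ j Bool.≟ true) (j , cong₂ _∧_ e e′)

  adjP-sound : ∀ {i i′} → adjP i i′ ≡ true → ∃ λ j → inc i j ≡ true × inc i′ j ≡ true
  adjP-sound {i} {i′} e with does-sound (any? λ j → inc i j ∧ inc i′ j Bool.≟ true) e
  ... | j , both = j , ∧-true both

  adjQ-true : ∀ {i j j′} → inc i j ≡ true → inc i j′ ≡ true → adjQ j j′ ≡ true
  adjQ-true {i} {j} {j′} e e′ = dec-true (any? λ i → inc i j ∧ inc i j′ Bool.≟ true) (i , cong₂ _∧_ e e′)

  adjQ-sound : ∀ {j j′} → adjQ j j′ ≡ true → ∃ λ i → inc i j ≡ true × inc i j′ ≡ true
  adjQ-sound {j} {j′} e with does-sound (any? λ i → inc i j ∧ inc i j′ Bool.≟ true) e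
  ... | i , both = i , ∧-true both

  module _ .{{_ : ℕ.NonZero a}} .{{_ : ℕ.NonZero b}}
    (degP : ∀ i → sum (λ j → indicator (inc i j)) ≡ a)
    (degQ : ∀ j → sum (λ i → indicator (inc i j)) ≡ b)
    (linear : ∀ {i i′ j j′} → inc i j ≡ true → inc i′ j ≡ true →
              inc i j′ ≡ true → inc i′ j′ ≡ true → i ≡ i′ ⊎ j ≡ j′) where

    private
      P = suc p
      Q = suc q

      real : ℕ → Dual
      real n = n , 0

      real-+ : ∀ x y → real (x ℕ.+ y) ≡ real x ⊕ real y
      real-+ x y = refl

      imag : ℕ → Dual
      imag n = 0 , n

      wP : Fin P → Fin (suc Q) → Dual
      wP i zero    = 0 , 0
      wP i (suc j) = real (indicator (inc i j))

      wQ : Fin Q → Fin (suc P) → Dual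
      wQ j zero    = 0 , 1
      wQ j (suc i) = real (indicator (inc i j))

      totP : ∀ i → 𝔻Σ.sum (wP i) ≡ (a , 0)
      totP i = trans (𝔻Σ.sum-suc (wP i)) (trans (sum-homo real refl real-+ _) (cong real (degP i)))

      totQ : ∀ j → 𝔻Σ.sum (wQ j) ≡ (b , 1)
      totQ j = trans (𝔻Σ.sum-suc (wQ j)) (cong ((0 , 1) ⊕_) (trans (sum-homo real refl real-+ _) (cong real (degQ j))))

      cancel-a : ∀ {u v} → (a , 0) ⊗ u ≡ (a , 0) ⊗ v → u ≡ v
      cancel-a {u , u′} {v , v′} eq = cong₂ _,_ (ℕ.*-cancelˡ-≡ u v a (cong proj₁ eq))
        (ℕ.*-cancelˡ-≡ u′ v′ a (ℕ.+-cancelʳ-≡ 0 _ _ (cong proj₂ eq)))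

      -- b + ε is not a scalar: b ≠ 0 first gives equal real parts, and then their common
      -- contribution to the ε-part can be removed.
      cancel-b : ∀ {u v} → (b , 1) ⊗ u ≡ (b , 1) ⊗ v → u ≡ v
      cancel-b {u , u′} {v , v′} eq with ℕ.*-cancelˡ-≡ u v b (cong proj₁ eq)
      ... | refl = cong (u ,_) (ℕ.*-cancelˡ-≡ u′ v′ b (ℕ.+-cancelʳ-≡ (1 ℕ.* u) _ _ (cong proj₂ eq)))

      module G = 𝔻Σ.Bipartite (a , 0) (b , 1) cancel-a cancel-b wP totP wQ totQ
      module GP = 𝔻Σ.Elimination (b , 1) cancel-b wQ totQ
      module GQ = 𝔻Σ.Elimination (a , 0) cancel-a wP totP

      -- A weight of the reduced graph counts common neighbours. Linearity allows at most one for
      -- distinct vertices, so the count is an indicator.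
      common : ∀ {n} (f g : Fin n → Bool) →
               (∀ i j → f i ∧ g i ≡ true → f j ∧ g j ≡ true → i ≡ j) →
               𝔻Σ.sum (λ i → real (indicator (f i)) ⊗ real (indicator (g i))) ≡
               real (indicator (does (any? λ i → f i ∧ g i Bool.≟ true)))
      common f g uniq = trans (𝔻Σ.sum-cong λ i → meet (f i) (g i))
        (trans (sum-homo real refl real-+ _) (cong real (sum-unique (λ i → f i ∧ g i) uniq)))
        where
        meet : ∀ x y → real (indicator x) ⊗ real (indicator y) ≡ real (indicator (x ∧ y))
        meet true  true  = refl
        meet true  false = refl
        meet false y     = refl

      -- Vertices of P have no ground edge of their own; each of the a neighbours in Q passes on its
      -- ε.
      groundP : ∀ i → GP.bypass wP i zero ≡ (0 , a)
      groundP i = cong₂ _⊕_ (𝔻Σ.zeroʳ (b , 1)) (trans (𝔻Σ.sum-cong λ j → edge (inc i j))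
          (trans (sum-homo imag refl (λ _ _ → refl) _) (cong imag (degP i))))
        where
        edge : ∀ x → real (indicator x) ⊗ (0 , 1) ≡ imag (indicator x)
        edge true  = refl
        edge false = refl

      -- Here the ε is the vertex's own, multiplied by the factor a left over in `bypass`; paths
      -- through P contribute nothing.
      groundQ : ∀ j → GQ.bypass wQ j zero ≡ (0 , a)
      groundQ j = trans (cong₂ _⊕_ ε-share (trans (𝔻Σ.sum-cong λ i → 𝔻Σ.zeroʳ (real (indicator (inc i j))))
          (trans (sum-homo real refl real-+ (λ _ → 0)) (cong real (sum-0 _ λ _ → refl)))))
        (cong imag (ℕ.+-identityʳ a))
        where
        ε-share : (a , 0) ⊗ (0 , 1) ≡ (0 , a)
        ε-share = cong₂ _,_ (ℕ.*-zeroʳ a) (trans (ℕ.+-identityʳ _) (ℕ.*-identityʳ a))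

      treesP : G.forests-A ≡ (0 , a ℕ.* treeCount adjP)
      treesP = TreeWeights.forests-count-trees adjP a (GP.bypass wP) groundP
        λ i i′ i≢i′ → common (inc i) (inc i′) λ j j′ e e′ →
          let (e₁ , e₂) = ∧-true e ; (e₃ , e₄) = ∧-true e′
          in [ (λ i≡i′ → ⊥-elim (i≢i′ i≡i′)) , (λ j≡j′ → j≡j′) ] (linear e₁ e₂ e₃ e₄)

      treesQ : G.forests-B ≡ (0 , a ℕ.* treeCount adjQ)
      treesQ = TreeWeights.forests-count-trees adjQ a (GQ.bypass wQ) groundQ
        λ j j′ j≢j′ → common (λ i → inc i j) (λ i → inc i j′) λ i i′ e e′ →
          let (e₁ , e₂) = ∧-true e ; (e₃ , e₄) = ∧-true e′
          in [ (λ i≡i′ → i≡i′) , (λ j≡j′ → ⊥-elim (j≢j′ j≡j′)) ] (linear e₁ e₃ e₂ e₄)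

      -- On multiples of ε only the real part of a factor acts, so a power of b + ε becomes a power
      -- of b.
      ^-imag : ∀ x x′ n c → (x , x′) 𝔻Σ.^ n ⊗ imag c ≡ imag (x ℕ.^ n ℕ.* c)
      ^-imag x x′ zero c = trans (𝔻Σ.*-identityˡ (imag c)) (sym (cong imag (ℕ.*-identityˡ c)))
      ^-imag x x′ (suc n) c = trans (𝔻Σ.*-assoc (x , x′) ((x , x′) 𝔻Σ.^ n) (imag c))
        (trans (cong ((x , x′) ⊗_) (^-imag x x′ n c))
          (cong₂ _,_ (ℕ.*-zeroʳ x) (trans (cong (x ℕ.* (x ℕ.^ n ℕ.* c) ℕ.+_) (ℕ.*-zeroʳ x′)) (trans (ℕ.+-identityʳ _) (sym (ℕ.*-assoc x (x ℕ.^ n) c))))))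

    trees-ratio : treeCount adjQ ℕ.* (a ℕ.* b) ℕ.^ P ≡ treeCount adjP ℕ.* (a ℕ.* b) ℕ.^ Q
    trees-ratio = sym (ℕ.*-cancelˡ-≡ _ _ a (begin
      a ℕ.* (treeCount adjP ℕ.* (a ℕ.* b) ℕ.^ Q)
        ≡⟨ cong (λ x → a ℕ.* (treeCount adjP ℕ.* x)) (^-distrib-* Q a b) ⟩
      a ℕ.* (treeCount adjP ℕ.* (a ℕ.^ Q ℕ.* b ℕ.^ Q))
        ≡⟨ shuffle a (treeCount adjP) (a ℕ.^ Q) (b ℕ.^ Q) ⟩
      a ℕ.^ Q ℕ.* (b ℕ.^ Q ℕ.* (a ℕ.* treeCount adjP))
        ≡⟨ cong proj₂ ratio ⟩
      b ℕ.^ P ℕ.* (a ℕ.^ P ℕ.* (a ℕ.* treeCount adjQ))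
        ≡⟨ shuffle′ a (treeCount adjQ) (a ℕ.^ P) (b ℕ.^ P) ⟨
      a ℕ.* (treeCount adjQ ℕ.* (a ℕ.^ P ℕ.* b ℕ.^ P))
        ≡⟨ cong (λ x → a ℕ.* (treeCount adjQ ℕ.* x)) (^-distrib-* P a b) ⟨
      a ℕ.* (treeCount adjQ ℕ.* (a ℕ.* b) ℕ.^ P) ∎))
      where
      open ≡-Reasoning
      shuffle : ∀ a t x y → a ℕ.* (t ℕ.* (x ℕ.* y)) ≡ x ℕ.* (y ℕ.* (a ℕ.* t))
      shuffle = solve-∀
      shuffle′ : ∀ a t x y → a ℕ.* (t ℕ.* (x ℕ.* y)) ≡ y ℕ.* (x ℕ.* (a ℕ.* t))
      shuffle′ = solve-∀
      ratio : imag (a ℕ.^ Q ℕ.* (b ℕ.^ Q ℕ.* (a ℕ.* treeCount adjP))) ≡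
              imag (b ℕ.^ P ℕ.* (a ℕ.^ P ℕ.* (a ℕ.* treeCount adjQ)))
      ratio = begin
        imag (a ℕ.^ Q ℕ.* (b ℕ.^ Q ℕ.* (a ℕ.* treeCount adjP)))
          ≡⟨ trans (cong ((a , 0) 𝔻Σ.^ Q ⊗_) (^-imag b 1 Q (a ℕ.* treeCount adjP))) (^-imag a 0 Q (b ℕ.^ Q ℕ.* (a ℕ.* treeCount adjP))) ⟨
        (a , 0) 𝔻Σ.^ Q ⊗ ((b , 1) 𝔻Σ.^ Q ⊗ imag (a ℕ.* treeCount adjP))
          ≡⟨ cong (λ u → (a , 0) 𝔻Σ.^ Q ⊗ ((b , 1) 𝔻Σ.^ Q ⊗ u)) treesP ⟨
        (a , 0) 𝔻Σ.^ Q ⊗ ((b , 1) 𝔻Σ.^ Q ⊗ G.forests-A)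
          ≡⟨ G.forests-ratio ⟩
        (b , 1) 𝔻Σ.^ P ⊗ ((a , 0) 𝔻Σ.^ P ⊗ G.forests-B)
          ≡⟨ cong (λ u → (b , 1) 𝔻Σ.^ P ⊗ ((a , 0) 𝔻Σ.^ P ⊗ u)) treesQ ⟩
        (b , 1) 𝔻Σ.^ P ⊗ ((a , 0) 𝔻Σ.^ P ⊗ imag (a ℕ.* treeCount adjQ))
          ≡⟨ trans (cong ((b , 1) 𝔻Σ.^ P ⊗_) (^-imag a 0 P (a ℕ.* treeCount adjQ))) (^-imag b 1 P (a ℕ.^ P ℕ.* (a ℕ.* treeCount adjQ))) ⟩
        imag (b ℕ.^ P ℕ.* (a ℕ.^ P ℕ.* (a ℕ.* treeCount adjQ))) ∎

-- Paths, parent maps and cycles in a finite graph.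

module _ {N : ℕ} where

  open DecMembership (Fin._≟_ {N}) using (_∈?_)

  module _ (E : Fin N → Fin N → Set) where

    data Path (r : Fin N) : Fin N → List (Fin N) → Set where
      arrive : Path r r (r ∷ [])
      leave  : ∀ {u w l} → E u w → Path r w l → All (u ≢_) l → Path r u (u ∷ l)

    FinCycle : Set
    FinCycle = ∃₂ λ x xs → 2 ≤ length xs × AllPairs _≢_ (x ∷ xs) × Linked E (x ∷ xs ++ x ∷ [])

  module _ {E : Fin N → Fin N → Set} where

    suffix : ∀ {r u w l} → Path E r w l → u ∈ l →
             ∃ λ l′ → Path E r u l′ × (∀ {P : Fin N → Set} → All P l → All P l′)
    suffix arrive          (here refl) = _ , arrive , λ ps → ps
    suffix p@(leave _ _ _) (here refl) = _ , p , λ ps → ps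
    suffix (leave _ p _)   (there u∈l) with suffix p u∈l
    ... | l′ , p′ , keep = l′ , p′ , λ { (_ ∷ ps) → keep ps }

    -- If u already lies on the simple path found for the rest of the walk, the path is restarted at
    -- that occurrence.
    loopErase : ∀ {u r} → Star E u r → ∃ (Path E r u)
    loopErase ε = _ , arrive
    loopErase {u} (e ◅ es) with loopErase es
    ... | l , p with u ∈? l
    ...   | yes u∈l = _ , proj₁ (proj₂ (suffix p u∈l))
    ...   | no  u∉l = _ , leave e p (All.tabulate λ { v∈l refl → u∉l v∈l })

    end∈ : ∀ {r u l} → Path E r u l → r ∈ l
    end∈ arrive        = here refl
    end∈ (leave _ p _) = there (end∈ p)

    start∈ : ∀ {r u l} → Path E r u l → u ∈ l
    start∈ arrive        = here refl
    start∈ (leave _ p _) = here refl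

  Avoiding : Fin N → (Fin N → Fin N → Set) → Fin N → Fin N → Set
  Avoiding i E u w = E u w × i ≢ u × i ≢ w

  module _ {E : Fin N → Fin N → Set} {i : Fin N} where

    avoid : ∀ {r u l} → Path E r u l → All (i ≢_) l → Star (Avoiding i E) u r
    avoid arrive        _            = ε
    avoid (leave e p _) (i≢u ∷ i≢l) = (e , i≢u , All.lookup i≢l (start∈ p)) ◅ avoid p i≢l

    -- Provides the parts of a cycle through i. The last component exposes the head of l, so that an
    -- edge from i to u can be put in front.
    closing : ∀ {r u l} → Path (Avoiding i E) r u l → E r i → i ≢ u →
              AllPairs _≢_ l × All (i ≢_) l × Linked E (l ++ i ∷ []) × (∃ λ l₀ → l ≡ u ∷ l₀)
    closing arrive e i≢r = [] ∷ [] , i≢r ∷ [] , e ∷ [-] , _ , refl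
    closing (leave (e′ , i≢u , i≢w) p u≢l) e _ with closing p e i≢w
    ... | distinct , i≢l , linked , l₀ , refl = u≢l ∷ distinct , i≢u ∷ i≢l , e′ ∷ linked , _ , refl

  module Parents (E : Fin N → Fin N → Set) (E-sym : ∀ {u w} → E u w → E w u)
                 (acyclic : ¬ FinCycle E) (r : Fin N) where

    -- Two different neighbours of i connected to r without visiting i would close a cycle through i.
    parent-unique : ∀ {i j j′ l l′} → E i j → Path E r j l → All (i ≢_) l →
                    E i j′ → Path E r j′ l′ → All (i ≢_) l′ → j ≡ j′
    parent-unique {i} {j} {j′} e p i≢l e′ p′ i≢l′ with j Fin.≟ j′
    ... | yes j≡j′ = j≡j′
    ... | no  j≢j′ with loopErase (avoid p i≢l ◅◅ reverse (λ (e , a , b) → E-sym e , b , a) (avoid p′ i≢l′))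
    ...   | _ , arrive = ⊥-elim (j≢j′ refl)
    -- The second use of `closing` only shows that the list of q is nonempty, so that the cycle has
    -- two vertices besides i.
    ...   | _ , path@(leave (_ , _ , i≢w) q _)
      with closing path (E-sym e′) (All.lookup i≢l (start∈ p)) | closing q (E-sym e′) i≢w
    ...     | distinct , i≢path , linked , _ , refl | _ , _ , _ , _ , refl =
              ⊥-elim (acyclic (i , _ , s≤s (s≤s z≤n) , i≢path ∷ distinct , e ∷ linked))

    firstStep : ∀ {u l} → Path E r u l → Fin (suc N)
    firstStep arrive             = zero
    firstStep (leave {w = w} _ _ _) = suc w

    module _ (E-irrefl : ∀ {u} → ¬ E u u) (connected : ∀ u → Star E u r) where

      parent : Fin N → Fin (suc N)
      parent u = firstStep (proj₂ (loopErase (connected u)))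

      parent-root : parent r ≡ zero
      parent-root with loopErase (connected r)
      ... | _ , arrive       = refl
      ... | _ , leave e p r≢l = ⊥-elim (All.lookup r≢l (end∈ p) refl)

      -- The walk from which `parent` was computed does not matter: by `parent-unique` any simple
      -- path to r gives the same first step.
      parent-suc : ∀ {i j l} → E i j → Path E r j l → All (i ≢_) l → parent i ≡ suc j
      parent-suc {i} e p i≢l with loopErase (connected i)
      ... | _ , arrive           = ⊥-elim (All.lookup i≢l (end∈ p) refl)
      ... | _ , leave e′ p′ i≢l′ = cong suc (parent-unique e′ p′ i≢l′ e p i≢l)

      parent-nonroot : ∀ u → u ≡ r ⊎ ∃₂ λ w l → parent u ≡ suc w × E u w × Path E r w l × All (u ≢_) l
      parent-nonroot u with loopErase (connected u)
      ... | _ , arrive       = inj₁ refl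
      ... | _ , leave e p u≢l = inj₂ (_ , _ , refl , e , p , u≢l)

      parents : Vec (Fin (suc N)) N
      parents = tabulate parent

      lookup-parents : ∀ u → lookup parents u ≡ parent u
      lookup-parents = lookup∘tabulate parent

      path-reaches : ∀ {u l} → Path E r u l → ∃ (Reaches parents (suc u))
      path-reaches arrive = _ , next (subst (λ t → Reaches parents t 0)
        (sym (trans (lookup-parents r) parent-root)) done)
      path-reaches {u} (leave e p u≢l) with path-reaches p
      ... | k , q = suc k , next (subst (λ t → Reaches parents t k)
        (sym (trans (lookup-parents u) (parent-suc e p u≢l))) q)

      parents-acyclic : Acyclic parents
      parents-acyclic zero    = _ , done
      parents-acyclic (suc u) = path-reaches (proj₂ (loopErase (connected u)))

      -- If w is off the simple path from u to r, the edge prolongs that path and u is the parent of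
      -- w. Otherwise the part of the path starting at w avoids u, and the edge followed by it shows
      -- that w is the parent of u.
      edge-parent : ∀ {u w} → E u w → parent u ≡ suc w ⊎ parent w ≡ suc u
      edge-parent {u} {w} e with loopErase (connected u)
      ... | l , p with w ∈? l
      ...   | no w∉l = inj₂ (parent-suc (E-sym e) p (All.tabulate λ { x∈l refl → w∉l x∈l }))
      edge-parent e | l , arrive     | yes (here refl)  = ⊥-elim (E-irrefl e)
      edge-parent e | _ , leave e′ p u≢l | yes (here refl)  = ⊥-elim (E-irrefl e)
      edge-parent {u} {w} e | _ , leave e′ p u≢l | yes (there w∈l) with suffix p w∈l
      ... | _ , q , keep = inj₁ (cong suc (parent-unique e′ p u≢l e q (keep u≢l)))

  module FromVector {adj : Fin N → Fin N → Bool} {v : Vec (Fin (suc N)) N} (tree : IsRootedTree adj v) where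
    open IsRootedTree tree

    Edge : Fin N → Fin N → Set
    Edge i j = lookup v i ≡ suc j ⊎ lookup v j ≡ suc i

    Edge-sym : ∀ {i j} → Edge i j → Edge j i
    Edge-sym = swap

    Edge-irrefl : ∀ {i} → ¬ Edge i i
    Edge-irrefl {i} (inj₁ eq) = Acyclic-loopless acyclic i eq
    Edge-irrefl {i} (inj₂ eq) = Acyclic-loopless acyclic i eq

    height : Fin N → ℕ
    height i = proj₁ (acyclic (suc i))

    level : ∀ {i t k} → lookup v i ≡ t → Reaches v t k → height i ≡ suc k
    level {i} refl p = Reaches-functional (proj₂ (acyclic (suc i))) (next p)

    height-suc : ∀ {i j} → lookup v i ≡ suc j → height i ≡ suc (height j)
    height-suc {i} {j} eq = level eq (proj₂ (acyclic (suc j)))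

    root-unique : ∀ {i} → lookup v i ≡ zero → i ≡ root
    root-unique {i} eq with links i
    ... | inj₁ i≡r = i≡r
    ... | inj₂ l = ⊥-elim (subst (Link adj i) eq l)

    -- Heights drop by one along the map; the bound on the heights of the later vertices shows that
    -- none of them equals i.
    descend : ∀ {i k} → Reaches v (suc i) k → ∃ λ l → Path Edge root i l × All (λ u → height u < suc k) l
    descend {i} {suc k} (next p) with lookup v i in eq
    ... | zero  = _ , subst (λ r → Path Edge r i (i ∷ [])) (root-unique eq) arrive , s≤s (ℕ.≤-reflexive (level eq p)) ∷ []
    ... | suc j with descend p
    ...   | l , path , low = i ∷ l , leave (inj₁ eq) path (All.map (λ { u<k refl → ℕ.<⇒≢ u<k (level eq p) }) low)
                           , s≤s (ℕ.≤-reflexive (level eq p)) ∷ All.map ℕ.m<n⇒m<1+n low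

    to-root : ∀ i → ∃ λ l → Path Edge root i l × All (λ u → height u < suc (height i)) l
    to-root i = descend (proj₂ (acyclic (suc i)))

    path⇒star : ∀ {r i l} → Path Edge r i l → Star Edge i r
    path⇒star arrive        = ε
    path⇒star (leave e p _) = e ◅ path⇒star p

    Edge-connected : ∀ i j → Star Edge i j
    Edge-connected i j = path⇒star (proj₁ (proj₂ (to-root i))) ◅◅ reverse Edge-sym (path⇒star (proj₁ (proj₂ (to-root j))))

    -- A walk without immediate reversals, with first edge (a , b) and last edge (y , z).
    data Trail : Fin N → Fin N → Fin N → Fin N → Set where
      one : ∀ {a b} → Edge a b → Trail a b a b
      _⟨_⟩∷_ : ∀ {a b c y z} → Edge a b → a ≢ c → Trail b c y z → Trail a b y z

    -- Once a trail moves away from the root it never turns: the only step towards the root leads to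
    -- the parent, which is the vertex just left.
    descending : ∀ {a b y z} → lookup v b ≡ suc a → Trail a b y z → lookup v z ≡ suc y × height a < height z
    descending eq (one _) = eq , ℕ.≤-reflexive (sym (height-suc eq))
    descending eq (_ ⟨ a≢c ⟩∷ t@(one (inj₁ eq′))) = ⊥-elim (a≢c (Fin.suc-injective (trans (sym eq) eq′)))
    descending eq (_ ⟨ a≢c ⟩∷ t@(inj₁ eq′ ⟨ _ ⟩∷ _)) = ⊥-elim (a≢c (Fin.suc-injective (trans (sym eq) eq′)))
    descending eq (_ ⟨ a≢c ⟩∷ t@(one (inj₂ eq′))) with descending eq′ t
    ... | last , up = last , ℕ.<-trans (ℕ.≤-reflexive (sym (height-suc eq))) up
    descending eq (_ ⟨ a≢c ⟩∷ t@(inj₂ eq′ ⟨ _ ⟩∷ _)) with descending eq′ t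
    ... | last , up = last , ℕ.<-trans (ℕ.≤-reflexive (sym (height-suc eq))) up

    -- A trail moves towards the root and, after at most one turn, away from it. Either its last
    -- edge lies after the turn, or the height has only dropped.
    trail-end : ∀ {a b y z} → Trail a b y z → lookup v z ≡ suc y ⊎ height z < height a
    trail-end (one (inj₁ eq)) = inj₂ (ℕ.≤-reflexive (sym (height-suc eq)))
    trail-end (one (inj₂ eq)) = inj₁ eq
    trail-end t@(inj₂ eq ⟨ _ ⟩∷ _) = inj₁ (proj₁ (descending eq t))
    trail-end (inj₁ eq ⟨ _ ⟩∷ t) with trail-end t
    ... | inj₁ last = inj₁ last
    ... | inj₂ down = inj₂ (ℕ.<-trans down (ℕ.≤-reflexive (sym (height-suc eq))))

    trail-of : ∀ {x} a b l → All (x ≢_) (a ∷ b ∷ l) → AllPairs _≢_ (a ∷ b ∷ l) →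
               Linked Edge (a ∷ b ∷ l ++ x ∷ []) → ∃ λ y → Trail a b y x × y ∈ b ∷ l
    trail-of a b []      (x≢a ∷ _) _ (e ∷ e′ ∷ _) = b , e ⟨ x≢a ∘ sym ⟩∷ one e′ , here refl
    trail-of a b (c ∷ l) (_ ∷ x≢) ((_ ∷ a≢c ∷ _) ∷ distinct) (e ∷ es)
      with trail-of b c l x≢ distinct es
    ... | y , t , y∈ = y , e ⟨ a≢c ⟩∷ t , there y∈

    -- A cycle is a trail from x back to x. Its height can neither only rise nor only drop, so it
    -- starts with the parent of x and also arrives from the parent of x, although its second and
    -- last vertices are distinct.
    no-cycle : ¬ FinCycle Edge
    no-cycle (x , x₁ ∷ [] , s≤s () , _)
    no-cycle (x , x₁ ∷ x₂ ∷ l , _ , (x≢x₁ ∷ x≢x₂ ∷ x≢l) ∷ (x₁≢ ∷ distinct) , e ∷ es)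
      with trail-of x₁ x₂ l (x≢x₁ ∷ x≢x₂ ∷ x≢l) (x₁≢ ∷ distinct) es
    ... | y , t , y∈ with e
    ...   | inj₂ down = ℕ.<-irrefl refl (proj₂ (descending down (e ⟨ x≢x₂ ⟩∷ t)))
    ...   | inj₁ up with trail-end (e ⟨ x≢x₂ ⟩∷ t)
    ...     | inj₂ lower = ℕ.<-irrefl refl lower
    ...     | inj₁ last  = All.lookup x₁≢ y∈ (Fin.suc-injective (trans (sym up) last))

  Path-map : ∀ {E E′ : Fin N → Fin N → Set} → (∀ {i j} → E i j → E′ i j) →
             ∀ {r u l} → Path E r u l → Path E′ r u l
  Path-map f arrive          = arrive
  Path-map f (leave e p u≢l) = leave (f e) (Path-map f p) u≢l

-- Rooted spanning trees of a finite setoid as parent vectors.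

module TreeVectors (V : Setoid (lsuc 0ℓ) 0ℓ) (Adj : Setoid.Carrier V → Setoid.Carrier V → Set)
  {N : ℕ} (I : Inverse V (setoid (Fin N))) (adj : Fin N → Fin N → Bool)
  (Adj⇒adj : ∀ u w → Adj u w → Inverse.to I u ≢ Inverse.to I w × adj (Inverse.to I u) (Inverse.to I w) ≡ true)
  (adj⇒Adj : ∀ u w → Inverse.to I u ≢ Inverse.to I w → adj (Inverse.to I u) (Inverse.to I w) ≡ true → Adj u w)
  (adj-sym : ∀ i j → adj i j ≡ true → adj j i ≡ true) where

  open Setoid V using (_≈_) renaming (Carrier to Vt; sym to ≈-sym; trans to ≈-trans)
  open Inverse I renaming (to to ix; from to rep; to-cong to ix-cong; from-cong to rep-cong)
  open SpanningTrees V Adj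

  private
    rep-ix : ∀ u → rep (ix u) ≈ u
    rep-ix = strictlyInverseʳ

    ix-rep : ∀ i → ix (rep i) ≡ i
    ix-rep = strictlyInverseˡ

    ix-injective : ∀ {u w} → ix u ≡ ix w → u ≈ w
    ix-injective {u} {w} eq = ≈-trans (≈-sym (rep-ix u)) (≈-trans (rep-cong eq) (rep-ix w))

  treeVectors : Setoid 0ℓ 0ℓ
  treeVectors = record
    { Carrier = ∃ (IsRootedTree adj)
    ; _≈_ = λ s t → proj₁ s ≡ proj₁ t
    ; isEquivalence = record { refl = refl ; sym = sym ; trans = trans }
    }

  module OfTree (S : SpanningTree) where

    EF : Fin N → Fin N → Set
    EF i j = E S (rep i) (rep j)

    E⇒EF : ∀ {u w} → E S u w → EF (ix u) (ix w)
    E⇒EF = E-resp S (≈-sym (rep-ix _)) (≈-sym (rep-ix _))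

    EF⇒E : ∀ {u w} → EF (ix u) (ix w) → E S u w
    EF⇒E = E-resp S (rep-ix _) (rep-ix _)

    EF-irrefl : ∀ {i} → ¬ EF i i
    EF-irrefl e = proj₁ (Adj⇒adj _ _ (E-adj S e)) refl

    EF-adj : ∀ {i j} → EF i j → adj i j ≡ true
    EF-adj e = subst₂ (λ i j → adj i j ≡ true) (ix-rep _) (ix-rep _) (proj₂ (Adj⇒adj _ _ (E-adj S e)))

    walk⇒star : ∀ {u w} → Walk (E S) u w → Star EF (ix u) (ix w)
    walk⇒star (stop u≈w)  = subst (Star EF _) (ix-cong u≈w) ε
    walk⇒star (step e es) = E⇒EF e ◅ walk⇒star es

    EF-connected : ∀ i j → Star EF i j
    EF-connected i j = subst₂ (Star EF) (ix-rep i) (ix-rep j) (walk⇒star (connected S (rep i) (rep j)))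

    EF-acyclic : ¬ FinCycle EF
    EF-acyclic (x , xs , long , distinct , linked) = acyclic S
      ( rep x , List.map rep xs , subst (2 ≤_) (sym (length-map rep xs)) long
      , AllPairs.map⁺ (AllPairs.map (λ i≢j eq → i≢j (trans (sym (ix-rep _)) (trans (ix-cong eq) (ix-rep _)))) distinct)
      , subst (Linked (E S)) (map-++ rep (x ∷ xs) (x ∷ [])) (Linked.map⁺ linked))

    module _ (r : Fin N) where
      private module P = Parents EF (E-sym S) EF-acyclic r

      parentVec : Vec (Fin (suc N)) N
      parentVec = P.parents EF-irrefl (λ i → EF-connected i r)

      lookup-parent : ∀ u → lookup parentVec u ≡ P.parent EF-irrefl (λ i → EF-connected i r) u
      lookup-parent = P.lookup-parents EF-irrefl (λ i → EF-connected i r)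

      at-root : lookup parentVec r ≡ zero
      at-root = trans (lookup-parent r) (P.parent-root EF-irrefl (λ i → EF-connected i r))

      at-nonroot : ∀ u → u ≡ r ⊎ ∃₂ λ w l → lookup parentVec u ≡ suc w × EF u w × Path EF r w l × All (u ≢_) l
      at-nonroot u with P.parent-nonroot EF-irrefl (λ i → EF-connected i r) u
      ... | inj₁ eq = inj₁ eq
      ... | inj₂ (w , l , eq , rest) = inj₂ (w , l , trans (lookup-parent u) eq , rest)

      at-path : ∀ {i j l} → EF i j → Path EF r j l → All (i ≢_) l → lookup parentVec i ≡ suc j
      at-path e p i≢l = trans (lookup-parent _) (P.parent-suc EF-irrefl (λ i → EF-connected i r) e p i≢l)

      at-edge : ∀ {u w} → EF u w → lookup parentVec u ≡ suc w ⊎ lookup parentVec w ≡ suc u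
      at-edge e with P.edge-parent EF-irrefl (λ i → EF-connected i r) e
      ... | inj₁ eq = inj₁ (trans (lookup-parent _) eq)
      ... | inj₂ eq = inj₂ (trans (lookup-parent _) eq)

      parentVec-tree : IsRootedTree adj parentVec
      parentVec-tree = rootedTree (P.parents-acyclic EF-irrefl (λ i → EF-connected i r)) r at-root links
        where
        links : ∀ z → z ≡ r ⊎ Link adj z (lookup parentVec z)
        links z with at-nonroot z
        ... | inj₁ eq = inj₁ eq
        ... | inj₂ (w , l , eq , e , _) = inj₂ (subst (Link adj z) (sym eq) (EF-adj e))

  lookup-ext : ∀ {n} {A : Set} (v w : Vec A n) → (∀ i → lookup v i ≡ lookup w i) → v ≡ w
  lookup-ext v w eq = trans (sym (tabulate∘lookup v)) (trans (tabulate-cong eq) (tabulate∘lookup w))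

  -- One inclusion is enough: simple paths of S are simple paths of T, and the acyclicity of T makes
  -- them determine its parents.
  parentVec-cong : ∀ (S T : SpanningTree) {r r′} → (∀ u w → E S u w → E T u w) → r ≡ r′ →
                   OfTree.parentVec S r ≡ OfTree.parentVec T r′
  parentVec-cong S T {r} S⇒T refl = lookup-ext _ _ same
    where
    module S = OfTree S
    module T = OfTree T
    same : ∀ u → lookup (S.parentVec r) u ≡ lookup (T.parentVec r) u
    same u with S.at-nonroot r u
    ... | inj₁ refl = trans (S.at-root r) (sym (T.at-root r))
    ... | inj₂ (w , l , eq , e , p , u≢l) =
      trans eq (sym (T.at-path r (S⇒T _ _ e) (Path-map (S⇒T _ _) p) u≢l))

  module OfVector {v : Vec (Fin (suc N)) N} (tree : IsRootedTree adj v) where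
    open FromVector tree public
    open IsRootedTree tree using (links)

    star⇒walk : ∀ {i j} → Star Edge i j → ∀ u w → ix u ≡ i → ix w ≡ j → Walk (λ u w → Edge (ix u) (ix w)) u w
    star⇒walk ε u w refl eq = stop (ix-injective (sym eq))
    star⇒walk (_◅_ {j = j} e es) u w refl eq =
      step (subst (Edge (ix u)) (sym (ix-rep j)) e) (star⇒walk es (rep j) w (ix-rep j) eq)

    parent-adj : ∀ {i j} → lookup v i ≡ suc j → adj i j ≡ true
    parent-adj {i} eq with links i
    ... | inj₂ l    = subst (Link adj i) eq l
    ... | inj₁ refl with trans (sym eq) (IsRootedTree.root-0 tree)
    ...   | ()

    Edge-adj : ∀ {i j} → Edge i j → adj i j ≡ true
    Edge-adj (inj₁ eq) = parent-adj eq
    Edge-adj (inj₂ eq) = adj-sym _ _ (parent-adj eq)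

    spanningTree : SpanningTree
    spanningTree = record
      { E         = λ u w → Edge (ix u) (ix w)
      ; E-resp    = λ u≈u′ w≈w′ → subst₂ Edge (ix-cong u≈u′) (ix-cong w≈w′)
      ; E-sym     = Edge-sym
      ; E-adj     = λ {u} {w} e → adj⇒Adj u w (λ eq → Edge-irrefl (subst (λ i → Edge i (ix w)) eq e)) (Edge-adj e)
      ; connected = λ u w → star⇒walk (Edge-connected (ix u) (ix w)) u w refl refl
      ; acyclic   = λ (x , xs , long , distinct , linked) → no-cycle
          ( ix x , List.map ix xs , subst (2 ≤_) (sym (length-map ix xs)) long
          , AllPairs.map⁺ (AllPairs.map (λ u≉w eq → u≉w (ix-injective eq)) distinct)
          , subst (Linked Edge) (map-++ ix (x ∷ xs) (x ∷ [])) (Linked.map⁺ linked))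
      }

  rootedTrees↔treeVectors : Inverse RootedTrees treeVectors
  rootedTrees↔treeVectors = record
    { to        = to
    ; from      = from
    ; to-cong   = λ {x} {y} → to-cong {x} {y}
    ; from-cong = λ {x} {y} → from-cong {x} {y}
    ; inverse   = (λ {x} {y} eq → trans (to-cong {y} {from x} eq) (to-from x))
                , (λ {x} {y} eq → Setoid.trans RootedTrees {from y} {from (to x)} {x} (from-cong {y} {to x} eq) (from-to x))
    }
    where
    to : SpanningTree × Vt → ∃ (IsRootedTree adj)
    to (S , ρ) = OfTree.parentVec S (ix ρ) , OfTree.parentVec-tree S (ix ρ)

    from : ∃ (IsRootedTree adj) → SpanningTree × Vt
    from (v , tree) = OfVector.spanningTree tree , rep (IsRootedTree.root tree)

    to-cong : ∀ {x y} → Setoid._≈_ RootedTrees x y → proj₁ (to x) ≡ proj₁ (to y)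
    to-cong {S , _} {T , _} (S⇔T , ρ≈) = parentVec-cong S T (λ u w → proj₁ (S⇔T u w)) (ix-cong ρ≈)

    from-cong : ∀ {x y} → proj₁ x ≡ proj₁ y → Setoid._≈_ RootedTrees (from x) (from y)
    from-cong {_ , s} {_ , t} refl =
      (λ u w → (λ e → e) , (λ e → e)) , rep-cong (OfVector.root-unique t (IsRootedTree.root-0 s))

    to-from : ∀ x → proj₁ (to (from x)) ≡ proj₁ x
    to-from (v , tree) = lookup-ext _ v same
      where
      open OfVector tree
      open IsRootedTree tree
      module T = OfTree spanningTree
      r = ix (rep root)

      Edge⇒EF : ∀ {i j} → Edge i j → T.EF i j
      Edge⇒EF = subst₂ Edge (sym (ix-rep _)) (sym (ix-rep _))

      same : ∀ z → lookup (T.parentVec r) z ≡ lookup v z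
      same z with lookup v z in eq
      ... | zero = subst (λ z → lookup (T.parentVec r) z ≡ zero) (trans (ix-rep root) (sym (root-unique eq))) (T.at-root r)
      ... | suc j with to-root j
      -- Heights on the path from j to the root are at most that of j, hence below that of z; so z
      -- is not on it.
      ...   | l , p , low = T.at-path r (Edge⇒EF (inj₁ eq))
        (subst (λ r → Path T.EF r j l) (sym (ix-rep root)) (Path-map Edge⇒EF p))
        (All.map (λ { h< refl → ℕ.<⇒≢ h< (height-suc eq) }) low)

    from-to : ∀ x → Setoid._≈_ RootedTrees (from (to x)) x
    from-to (S , ρ) = (λ u w → forth , back) , rep-ix ρ
      where
      module S = OfTree S
      v = S.parentVec (ix ρ)

      back : ∀ {u w} → E S u w → lookup v (ix u) ≡ suc (ix w) ⊎ lookup v (ix w) ≡ suc (ix u)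
      back e = S.at-edge (ix ρ) (S.E⇒EF e)

      up : ∀ {u w} → lookup v (ix u) ≡ suc (ix w) → E S u w
      up {u} eq with S.at-nonroot (ix ρ) (ix u)
      ... | inj₂ (w′ , _ , eq′ , e , _) = S.EF⇒E (subst (S.EF (ix u)) (Fin.suc-injective (trans (sym eq′) eq)) e)
      ... | inj₁ u≡r with trans (sym eq) (trans (cong (lookup v) u≡r) (S.at-root (ix ρ)))
      ...   | ()

      forth : ∀ {u w} → lookup v (ix u) ≡ suc (ix w) ⊎ lookup v (ix w) ≡ suc (ix u) → E S u w
      forth (inj₁ eq) = up eq
      forth (inj₂ eq) = E-sym S (up eq)

-- Enumerating and counting finite setoids.

module _ {a ℓ} (S : Setoid a ℓ) (_≈?_ : ∀ x y → Dec (Setoid._≈_ S x y)) where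
  open Setoid S renaming (refl to ≈-refl; sym to ≈-sym; trans to ≈-trans)

  -- A candidate list without its repetitions. Candidates may be rejected by `nothing`, which for
  -- subspaces happens to linearly dependent tuples.
  record Sieve {M} (e : Fin M → Maybe Carrier) : Set (a Level.⊔ ℓ) where
    field
      size      : ℕ
      rep       : Fin size → Carrier
      injective : ∀ {i j} → rep i ≈ rep j → i ≡ j
      covers    : ∀ i {s} → e i ≡ just s → ∃ λ j → rep j ≈ s

  sieve : ∀ {M} (e : Fin M → Maybe Carrier) → Sieve e
  sieve {zero}  e = record { size = 0 ; rep = λ () ; injective = λ { {()} } ; covers = λ () }
  sieve {suc M} e with sieve (e ∘ suc) | e zero in eq
  ... | s | nothing = record
    { Sieve s ; covers = λ { zero eq′ → ⊥-elim (absurd (trans (sym eq) eq′)) ; (suc i) → Sieve.covers s i } }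
    where
    absurd : ∀ {x} → nothing ≡ just x → ⊥
    absurd ()
  ... | s | just x with any? (λ j → Sieve.rep s j ≈? x)
  ...   | yes (j , j≈x) = record
    { Sieve s ; covers = λ { zero eq′ → j , subst (_ ≈_) (just-inj (trans (sym eq) eq′)) j≈x ; (suc i) → Sieve.covers s i } }
    where
    just-inj : ∀ {x y : Carrier} → just x ≡ just y → x ≡ y
    just-inj refl = refl
  ...   | no fresh = record { size = suc (Sieve.size s) ; rep = rep ; injective = injective ; covers = covers }
    where
    rep : Fin (suc (Sieve.size s)) → Carrier
    rep zero    = x
    rep (suc i) = Sieve.rep s i

    injective : ∀ {i j} → rep i ≈ rep j → i ≡ j
    injective {zero}  {zero}  _ = refl
    injective {zero}  {suc j} p = ⊥-elim (fresh (j , ≈-sym p))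
    injective {suc i} {zero}  p = ⊥-elim (fresh (i , p))
    injective {suc i} {suc j} p = cong suc (Sieve.injective s p)

    covers : ∀ i {y} → e i ≡ just y → ∃ λ j → rep j ≈ y
    covers zero eq′ with trans (sym eq) eq′
    ... | refl = zero , ≈-refl
    covers (suc i) eq′ with Sieve.covers s i eq′
    ... | j , p = suc j , p

  enumerate : ∀ {M} (e : Fin M → Maybe Carrier) → (∀ s → ∃₂ λ i s′ → e i ≡ just s′ × s′ ≈ s) →
              ∃ λ n → Inverse S (setoid (Fin n))
  enumerate e complete = size , record
    { to        = ix
    ; from      = rep
    ; to-cong   = λ {s} {t} s≈t → injective (≈-trans (rep-ix s) (≈-trans s≈t (≈-sym (rep-ix t))))
    ; from-cong = λ { refl → ≈-refl }
    ; inverse   = (λ {i} {s} s≈ → injective (≈-trans (rep-ix s) s≈))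
                , (λ { {s} refl → rep-ix s })
    }
    where
    open Sieve (sieve e)
    find : ∀ s → ∃ λ j → rep j ≈ s
    find s with complete s
    ... | i , s′ , eq , s′≈s with covers i eq
    ...   | j , p = j , ≈-trans p s′≈s
    ix : Carrier → Fin size
    ix s = proj₁ (find s)
    rep-ix : ∀ s → rep (ix s) ≈ s
    rep-ix s = proj₂ (find s)

Σ-↔Fin : ∀ {n} {B : Fin n → Set} (c : Fin n → ℕ) → (∀ i → B i ↔ Fin (c i)) → Σ (Fin n) B ↔ Fin (sum c)
Σ-↔Fin {zero} c _ = subst (λ k → _ ↔ Fin k) (sym (ℕΣ.sum-empty c))
  (mk↔ₛ′ (λ { (() , _) }) (λ ()) (λ ()) (λ { (() , _) }))
Σ-↔Fin {suc n} {B} c B↔ = subst (λ k → _ ↔ Fin k) (sym (ℕΣ.sum-suc c))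
  (↔-trans split (↔-trans (B↔ zero ⊎-↔ Σ-↔Fin (c ∘ suc) (B↔ ∘ suc)) (↔-sym Fin.+↔⊎)))
  where
  split : Σ (Fin (suc n)) B ↔ (B zero ⊎ Σ (Fin n) (B ∘ suc))
  split = mk↔ₛ′ (λ { (zero , b) → inj₁ b ; (suc i , b) → inj₂ (i , b) })
                (λ { (inj₁ b) → zero , b ; (inj₂ (i , b)) → suc i , b })
                (λ { (inj₁ b) → refl ; (inj₂ _) → refl })
                (λ { (zero , b) → refl ; (suc i , b) → refl })

≡true↔Fin : ∀ b → (b ≡ true) ↔ Fin (indicator b)
≡true↔Fin false = mk↔ₛ′ (λ ()) (λ ()) (λ ()) (λ ())
≡true↔Fin true  = mk↔ₛ′ (λ _ → zero) (λ _ → refl) (λ { zero → refl }) (λ { refl → refl })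

subset↔Fin : ∀ {n} (P : Fin n → Bool) → (Σ (Fin n) λ i → P i ≡ true) ↔ Fin (sum (indicator ∘ P))
subset↔Fin P = Σ-↔Fin (indicator ∘ P) (≡true↔Fin ∘ P)

subset-size : ∀ {n c} (P : Fin n → Bool) → (Σ (Fin n) λ i → P i ≡ true) ↔ Fin c → sum (indicator ∘ P) ≡ c
subset-size P P↔ = Perm.↔⇒≡ (↔-trans (↔-sym (subset↔Fin P)) P↔)

vecSubset↔Fin : ∀ {n k} (P : Vec (Fin k) n → Bool) → (Σ (Vec (Fin k) n) λ v → P v ≡ true) ↔ Fin (countV P)
vecSubset↔Fin {zero} P = ↔-trans (mk↔ₛ′ (λ { ([] , p) → p }) ([] ,_) (λ _ → refl) (λ { ([] , _) → refl })) (≡true↔Fin (P []))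
vecSubset↔Fin {suc n} {k} P = ↔-trans uncons (Σ-↔Fin _ λ t → vecSubset↔Fin (P ∘ (t ∷_)))
  where
  uncons : (Σ (Vec (Fin k) (suc n)) λ v → P v ≡ true) ↔ (Σ (Fin k) λ t → Σ (Vec (Fin k) n) λ v → P (t ∷ v) ≡ true)
  uncons = mk↔ₛ′ (λ { (t ∷ v , p) → t , v , p }) (λ { (t , v , p) → t ∷ v , p })
                 (λ _ → refl) (λ { (t ∷ v , p) → refl })

Vec↔Fin : ∀ {A : Set} {q} → A ↔ Fin q → ∀ n → Vec A n ↔ Fin (q ℕ.^ n)
Vec↔Fin A↔ zero    = mk↔ₛ′ (λ _ → zero) (λ _ → []) (λ { zero → refl }) (λ { [] → refl })
Vec↔Fin {A} A↔ (suc n) = ↔-trans uncons (↔-trans (A↔ ×-↔ Vec↔Fin A↔ n) (↔-sym Fin.*↔×))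
  where
  uncons : Vec A (suc n) ↔ (A × Vec A n)
  uncons = mk↔ₛ′ (λ { (x ∷ v) → x , v }) (λ { (x , v) → x ∷ v }) (λ _ → refl) (λ { (_ ∷ _) → refl })

module _ {A : Set} {n} (A↔ : A ↔ Fin n) {P : A → Set} (P? : Decidable P) where
  open Inverse A↔

  abstract
    finite-any? : Dec (∃ P)
    finite-any? = map′ (λ (i , p) → from i , p) (λ (x , p) → to x , subst P (sym (strictlyInverseʳ x)) p)
      (any? (P? ∘ from))

    finite-all? : Dec (∀ x → P x)
    finite-all? = map′ (λ ps x → subst P (strictlyInverseʳ x) (ps (to x))) (λ ps i → ps (from i)) (all? (P? ∘ from))

subsetoid : ∀ {a ℓ} (P : Setoid a ℓ) → (Setoid.Carrier P → Set) → Setoid a ℓ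
subsetoid P Q = record
  { Carrier = Σ (Setoid.Carrier P) Q
  ; _≈_ = λ x y → Setoid._≈_ P (proj₁ x) (proj₁ y)
  ; isEquivalence = record { refl = Setoid.refl P ; sym = Setoid.sym P ; trans = Setoid.trans P }
  }

×-≅Fin : ∀ {a ℓ b ℓ′ m n} {S : Setoid a ℓ} {T : Setoid b ℓ′} →
         Inverse S (setoid (Fin m)) → Inverse T (setoid (Fin n)) → Inverse (×-setoid S T) (setoid (Fin (m ℕ.* n)))
×-≅Fin {S = S} {T} f g = record
  { to        = λ (s , t) → Fin.combine (F.to s) (G.to t)
  ; from      = λ k → F.from (proj₁ (C.to k)) , G.from (proj₂ (C.to k))
  ; to-cong   = λ (p , q) → cong₂ Fin.combine (F.to-cong p) (G.to-cong q)
  ; from-cong = λ { refl → Setoid.refl S , Setoid.refl T }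
  ; inverse   = (λ {k} (p , q) → trans (cong₂ Fin.combine (F.inverseˡ p) (G.inverseˡ q)) (C.strictlyInverseʳ k))
              , (λ { {s , t} refl → F.inverseʳ (cong proj₁ (C.strictlyInverseˡ (F.to s , G.to t)))
                                 , G.inverseʳ (cong proj₂ (C.strictlyInverseˡ (F.to s , G.to t))) })
  }
  where
  module F = Inverse f
  module G = Inverse g
  module C = Inverse (Fin.*↔× {_} {_})

module _ (I P : Setoid (lsuc 0ℓ) 0ℓ) (R : Setoid.Carrier I → Setoid.Carrier P → Set)
  (R-resp : ∀ {i j p} → Setoid._≈_ I i j → R i p → R j p)
  {N c} (idx : Inverse I (setoid (Fin N)))
  (fibre : ∀ k → Inverse (subsetoid P (R (Inverse.from idx k))) (setoid (Fin c))) where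
  private
    module I = Setoid I
    module P = Setoid P
    module X = Inverse idx
    module F k = Inverse (fibre k)
    module V = Inverse (Vec↔Fin (↔-refl {A = Fin c}) N)

  -- A well-defined choice function is fixed by its values at the representatives, and `R-resp`
  -- extends a choice made there to the whole class.
  ΠSetoid-≅Fin : Inverse (ΠSetoid I P R) (setoid (Fin (c ℕ.^ N)))
  ΠSetoid-≅Fin = Compose.inverse {S = setoid (Vec (Fin c) N)} (record
    { to        = to
    ; from      = from
    ; to-cong   = λ {f} {g} → to-cong {f} {g}
    ; from-cong = λ { refl i → P.refl }
    ; inverse   = (λ {v} {f} eq → trans (to-cong {f} {from v} eq) (to-from v)) , λ { {f} refl → from-to f }
    }) (Vec↔Fin ↔-refl N)
    where
    Fun = Setoid.Carrier (ΠSetoid I P R)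

    to : Fun → Vec (Fin c) N
    to (f , _ , r) = tabulate λ k → F.to k (f (X.from k) , r (X.from k))

    from : Vec (Fin c) N → Fun
    from v = (λ i → proj₁ (F.from (X.to i) (lookup v (X.to i))))
           , (λ i≈j → P.reflexive (cong (λ k → proj₁ (F.from k (lookup v k))) (X.to-cong i≈j)))
           , (λ i → R-resp (X.strictlyInverseʳ i) (proj₂ (F.from (X.to i) (lookup v (X.to i)))))

    to-cong : ∀ {f g : Fun} → Setoid._≈_ (ΠSetoid I P R) f g → to f ≡ to g
    to-cong eq = tabulate-cong λ k → F.to-cong k (eq (X.from k))

    to-from : ∀ v → to (from v) ≡ v
    to-from v = trans (tabulate-cong λ k → F.inverseˡ k
      (P.reflexive (cong (λ k → proj₁ (F.from k (lookup v k))) (X.strictlyInverseˡ k)))) (tabulate∘lookup v)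

    from-to : ∀ f → Setoid._≈_ (ΠSetoid I P R) (from (to f)) f
    from-to (f , f-cong , r) i = P.trans
      (P.reflexive (cong (λ x → proj₁ (F.from (X.to i) x)) (lookup∘tabulate _ (X.to i))))
      (P.trans (F.strictlyInverseʳ (X.to i) _) (f-cong (X.strictlyInverseʳ i)))

-- Linear algebra over a finite field by counting.

module Subspaces (F : FiniteField) where
  open FiniteField F
  open LinearAlgebra F
  open IsCommutativeRing isCommutativeRing using (+-assoc; +-comm; +-identityˡ; +-identityʳ; *-assoc; *-comm; *-identityˡ; distribˡ; distribʳ; zeroˡ; zeroʳ; -‿inverseˡ)

  infixr 8 _·ᵥ_
  infixl 6 _+ᵥ_
  _+ᵥ_ : ∀ {n} → Vector n → Vector n → Vector n
  _+ᵥ_ = _+V_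
  _·ᵥ_ : ∀ {n} → Carrier → Vector n → Vector n
  _·ᵥ_ = _·V_

  +ᵥ-assoc : ∀ {n} (u v w : Vector n) → (u +ᵥ v) +ᵥ w ≡ u +ᵥ (v +ᵥ w)
  +ᵥ-assoc = zipWith-assoc +-assoc

  +ᵥ-comm : ∀ {n} (u v : Vector n) → u +ᵥ v ≡ v +ᵥ u
  +ᵥ-comm = zipWith-comm +-comm

  +ᵥ-identityˡ : ∀ {n} (u : Vector n) → zeroV +ᵥ u ≡ u
  +ᵥ-identityˡ = zipWith-identityˡ +-identityˡ

  +ᵥ-identityʳ : ∀ {n} (u : Vector n) → u +ᵥ zeroV ≡ u
  +ᵥ-identityʳ = zipWith-identityʳ +-identityʳ

  ·ᵥ-distribˡ : ∀ {n} c (u v : Vector n) → c ·ᵥ (u +ᵥ v) ≡ c ·ᵥ u +ᵥ c ·ᵥ v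
  ·ᵥ-distribˡ c []      []      = refl
  ·ᵥ-distribˡ c (x ∷ u) (y ∷ v) = cong₂ _∷_ (distribˡ c x y) (·ᵥ-distribˡ c u v)

  ·ᵥ-distribʳ : ∀ {n} c d (u : Vector n) → (c + d) ·ᵥ u ≡ c ·ᵥ u +ᵥ d ·ᵥ u
  ·ᵥ-distribʳ c d []      = refl
  ·ᵥ-distribʳ c d (x ∷ u) = cong₂ _∷_ (distribʳ x c d) (·ᵥ-distribʳ c d u)

  ·ᵥ-assoc : ∀ {n} c d (u : Vector n) → (c * d) ·ᵥ u ≡ c ·ᵥ d ·ᵥ u
  ·ᵥ-assoc c d []      = refl
  ·ᵥ-assoc c d (x ∷ u) = cong₂ _∷_ (*-assoc c d x) (·ᵥ-assoc c d u)

  ·ᵥ-identity : ∀ {n} (u : Vector n) → 1# ·ᵥ u ≡ u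
  ·ᵥ-identity []      = refl
  ·ᵥ-identity (x ∷ u) = cong₂ _∷_ (*-identityˡ x) (·ᵥ-identity u)

  ·ᵥ-zeroˡ : ∀ {n} (u : Vector n) → 0# ·ᵥ u ≡ zeroV
  ·ᵥ-zeroˡ []      = refl
  ·ᵥ-zeroˡ (x ∷ u) = cong₂ _∷_ (zeroˡ x) (·ᵥ-zeroˡ u)

  ·ᵥ-zeroʳ : ∀ {n} c → c ·ᵥ zeroV {n} ≡ zeroV
  ·ᵥ-zeroʳ {zero}  c = refl
  ·ᵥ-zeroʳ {suc n} c = cong₂ _∷_ (zeroʳ c) (·ᵥ-zeroʳ c)

  neg-cancel : ∀ {n} c (u : Vector n) → (- c) ·ᵥ u +ᵥ c ·ᵥ u ≡ zeroV
  neg-cancel c u = trans (sym (·ᵥ-distribʳ (- c) c u)) (trans (cong (_·ᵥ u) (-‿inverseˡ c)) (·ᵥ-zeroˡ u))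

  move : ∀ {n} c (u w : Vector n) {x} → c ·ᵥ u +ᵥ w ≡ x → w ≡ (- c) ·ᵥ u +ᵥ x
  move c u w refl = sym (trans (sym (+ᵥ-assoc _ _ w)) (trans (cong (_+ᵥ w) (neg-cancel c u)) (+ᵥ-identityˡ w)))

  difference-zero : ∀ {n} (u v : Vector n) → (- 1#) ·ᵥ v +ᵥ u ≡ zeroV → u ≡ v
  difference-zero u v eq = begin
    u                                  ≡⟨ +ᵥ-identityˡ u ⟨
    zeroV +ᵥ u                         ≡⟨ cong (_+ᵥ u) (trans (+ᵥ-comm _ _) (neg-cancel 1# v)) ⟨
    1# ·ᵥ v +ᵥ (- 1#) ·ᵥ v +ᵥ u        ≡⟨ +ᵥ-assoc _ _ u ⟩
    1# ·ᵥ v +ᵥ ((- 1#) ·ᵥ v +ᵥ u)      ≡⟨ cong₂ _+ᵥ_ (·ᵥ-identity v) eq ⟩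
    v +ᵥ zeroV                         ≡⟨ +ᵥ-identityʳ v ⟩
    v                                  ∎
    where open ≡-Reasoning

  interchange : ∀ {n} (a b c d : Vector n) → (a +ᵥ b) +ᵥ (c +ᵥ d) ≡ (a +ᵥ c) +ᵥ (b +ᵥ d)
  interchange a b c d = begin
    (a +ᵥ b) +ᵥ (c +ᵥ d) ≡⟨ +ᵥ-assoc a b _ ⟩
    a +ᵥ (b +ᵥ (c +ᵥ d)) ≡⟨ cong (a +ᵥ_) (trans (sym (+ᵥ-assoc b c d)) (trans (cong (_+ᵥ d) (+ᵥ-comm b c)) (+ᵥ-assoc c b d))) ⟩
    a +ᵥ (c +ᵥ (b +ᵥ d)) ≡⟨ +ᵥ-assoc a c _ ⟨
    (a +ᵥ c) +ᵥ (b +ᵥ d) ∎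
    where open ≡-Reasoning

  lincomb-0 : ∀ {n k} (bs : Vec (Vector n) k) → lincomb zeroV bs ≡ zeroV
  lincomb-0 []       = refl
  lincomb-0 (b ∷ bs) = trans (cong₂ _+ᵥ_ (·ᵥ-zeroˡ b) (lincomb-0 bs)) (+ᵥ-identityˡ zeroV)

  lincomb-+ : ∀ {n k} cs ds (bs : Vec (Vector n) k) → lincomb (cs +ᵥ ds) bs ≡ lincomb cs bs +ᵥ lincomb ds bs
  lincomb-+ []       []       []       = sym (+ᵥ-identityˡ zeroV)
  lincomb-+ (c ∷ cs) (d ∷ ds) (b ∷ bs) = trans (cong₂ _+ᵥ_ (·ᵥ-distribʳ c d b) (lincomb-+ cs ds bs)) (interchange _ _ _ _)

  lincomb-· : ∀ {n k} c cs (bs : Vec (Vector n) k) → lincomb (c ·ᵥ cs) bs ≡ c ·ᵥ lincomb cs bs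
  lincomb-· c []       []       = sym (·ᵥ-zeroʳ c)
  lincomb-· c (d ∷ ds) (b ∷ bs) = trans (cong₂ _+ᵥ_ (·ᵥ-assoc c d b) (lincomb-· c ds bs)) (sym (·ᵥ-distribˡ c _ _))

  unit : ∀ {k} → Fin k → Vec Carrier k
  unit zero    = 1# ∷ zeroV
  unit (suc i) = 0# ∷ unit i

  lincomb-unit : ∀ {n k} (bs : Vec (Vector n) k) i → lincomb (unit i) bs ≡ lookup bs i
  lincomb-unit (b ∷ bs) zero    = trans (cong₂ _+ᵥ_ (·ᵥ-identity b) (lincomb-0 bs)) (+ᵥ-identityʳ b)
  lincomb-unit (b ∷ bs) (suc i) = trans (cong₂ _+ᵥ_ (·ᵥ-zeroˡ b) (lincomb-unit bs i)) (+ᵥ-identityˡ _)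

  lincomb-map : ∀ {n k l} ds (ws : Vec (Vector k) l) (bs : Vec (Vector n) k) →
                lincomb ds (map (λ cs → lincomb cs bs) ws) ≡ lincomb (lincomb ds ws) bs
  lincomb-map []       []       bs = sym (lincomb-0 bs)
  lincomb-map (d ∷ ds) (w ∷ ws) bs = begin
    d ·ᵥ lincomb w bs +ᵥ lincomb ds (map (λ cs → lincomb cs bs) ws)
      ≡⟨ cong₂ _+ᵥ_ (sym (lincomb-· d w bs)) (lincomb-map ds ws bs) ⟩
    lincomb (d ·ᵥ w) bs +ᵥ lincomb (lincomb ds ws) bs
      ≡⟨ lincomb-+ (d ·ᵥ w) (lincomb ds ws) bs ⟨
    lincomb (d ·ᵥ w +ᵥ lincomb ds ws) bs ∎
    where open ≡-Reasoning

  mem-lincomb : ∀ {n k} (X : Subspace n) (bs : Vec (Vector n) k) → (∀ i → mem X (lookup bs i)) →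
                ∀ cs → mem X (lincomb cs bs)
  mem-lincomb X []       bs∈X []       = mem-zero X
  mem-lincomb X (b ∷ bs) bs∈X (c ∷ cs) = mem-+ X (mem-· X c (bs∈X zero)) (mem-lincomb X bs (bs∈X ∘ suc) cs)

  span : ∀ {n k} → Vec (Vector n) k → Subspace n
  span bs = record
    { mem      = λ v → ∃ λ cs → lincomb cs bs ≡ v
    ; mem-zero = zeroV , lincomb-0 bs
    ; mem-+    = λ { (cs , refl) (ds , refl) → cs +ᵥ ds , lincomb-+ cs ds bs }
    ; mem-·    = λ { c (cs , refl) → c ·ᵥ cs , lincomb-· c cs bs }
    }

  Independent : ∀ {n k} → Vec (Vector n) k → Set
  Independent {k = k} bs = ∀ cs → lincomb cs bs ≡ zeroV → cs ≡ replicate k 0#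

  span-basis : ∀ {n k} (bs : Vec (Vector n) k) → Independent bs → Basis (span bs) k
  span-basis bs indep = record
    { vecs = bs ; inX = λ i → unit i , lincomb-unit bs i ; indep = indep ; spans = λ v v∈ → v∈ }

  span-⊆ : ∀ {n k} (X : Subspace n) (bs : Vec (Vector n) k) → (∀ i → mem X (lookup bs i)) → span bs ⊆ X
  span-⊆ X bs bs∈X _ (cs , refl) = mem-lincomb X bs bs∈X cs

  lincomb-injective : ∀ {n k} (bs : Vec (Vector n) k) → Independent bs →
                      ∀ {cs ds} → lincomb cs bs ≡ lincomb ds bs → cs ≡ ds
  lincomb-injective bs indep {cs} {ds} eq = difference-zero cs ds (indep _ (begin
    lincomb ((- 1#) ·ᵥ ds +ᵥ cs) bs             ≡⟨ lincomb-+ ((- 1#) ·ᵥ ds) cs bs ⟩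
    lincomb ((- 1#) ·ᵥ ds) bs +ᵥ lincomb cs bs  ≡⟨ cong₂ _+ᵥ_ (lincomb-· (- 1#) ds bs) eq ⟩
    (- 1#) ·ᵥ lincomb ds bs +ᵥ lincomb ds bs    ≡⟨ cong ((- 1#) ·ᵥ lincomb ds bs +ᵥ_) (sym (·ᵥ-identity _)) ⟩
    (- 1#) ·ᵥ lincomb ds bs +ᵥ 1# ·ᵥ lincomb ds bs ≡⟨ neg-cancel 1# (lincomb ds bs) ⟩
    zeroV                                       ∎))
    where open ≡-Reasoning

  abstract
   carrier-enumeration : ∃ λ q → Carrier ↔ Fin q
   carrier-enumeration = enumerate (setoid Carrier) _≟_ (just ∘ List.lookup elements)
    (λ x → index (complete x) , x , cong just (sym (lookup-index (complete x))) , refl)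

  q : ℕ
  q = proj₁ carrier-enumeration

  carrier↔ : Carrier ↔ Fin q
  carrier↔ = proj₂ carrier-enumeration

  1<q : 1 < q
  1<q = go q carrier↔
    where
    go : ∀ q → Carrier ↔ Fin q → 1 < q
    go zero          f with Inverse.to f 0#
    ... | ()
    go (suc zero)    f = ⊥-elim (0≢1 (trans (sym (Inverse.strictlyInverseʳ f 0#))
      (trans (cong (Inverse.from f) (one (Inverse.to f 0#) (Inverse.to f 1#))) (Inverse.strictlyInverseʳ f 1#))))
      where
      one : (i j : Fin 1) → i ≡ j
      one zero zero = refl
    go (suc (suc _)) f = s≤s (s≤s z≤n)

  vector↔ : ∀ n → Vector n ↔ Fin (q ℕ.^ n)
  vector↔ = Vec↔Fin carrier↔

  tuples↔ : ∀ n k → Vec (Vector n) k ↔ Fin ((q ℕ.^ n) ℕ.^ k)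
  tuples↔ n = Vec↔Fin (vector↔ n)

  _≟ᵥ_ : ∀ {n} (u v : Vector n) → Dec (u ≡ v)
  _≟ᵥ_ = ≡-dec _≟_

  -- Dimensions are compared through cardinalities, q ^ k against q ^ l with 1 < q, in place of the
  -- Steinitz exchange argument.
  injection⇒≤ : ∀ {k l} (f : Vector k → Vector l) → (∀ {u v} → f u ≡ f v → u ≡ v) → k ≤ l
  injection⇒≤ {k} {l} f inj with k ℕ.≤? l
  ... | yes k≤l = k≤l
  ... | no  k≰l = ⊥-elim (ℕ.<⇒≱ (ℕ.^-monoʳ-< q 1<q (ℕ.≰⇒> k≰l))
    (injective⇒≤ {f = Inverse.to (vector↔ l) ∘ f ∘ Inverse.from (vector↔ k)} λ {i} {j} eq →
      trans (sym (Inverse.strictlyInverseˡ (vector↔ k) i))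
        (trans (cong (Inverse.to (vector↔ k)) (inj (trans (sym (Inverse.strictlyInverseʳ (vector↔ l) _))
          (trans (cong (Inverse.from (vector↔ l)) eq) (Inverse.strictlyInverseʳ (vector↔ l) _)))))
        (Inverse.strictlyInverseˡ (vector↔ k) j))))

  independent? : ∀ {n k} (bs : Vec (Vector n) k) → Dec (Independent bs)
  independent? {k = k} bs = finite-all? (vector↔ k) λ cs → dec→ (lincomb cs bs ≟ᵥ zeroV) (cs ≟ᵥ zeroV)
    where
    dec→ : ∀ {A B : Set} → Dec A → Dec B → Dec (A → B)
    dec→ _       (yes b) = yes λ _ → b
    dec→ (no ¬a) _       = yes λ a → ⊥-elim (¬a a)
    dec→ (yes a) (no ¬b) = no λ f → ¬b (f a)

  module _ {n k} {X : Subspace n} (bX : Basis X k) where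
    open Basis bX

    coords : ∀ {v} → mem X v → Vec Carrier k
    coords v∈X = proj₁ (spans _ v∈X)

    lincomb-coords : ∀ {v} (v∈X : mem X v) → lincomb (coords v∈X) vecs ≡ v
    lincomb-coords v∈X = proj₂ (spans _ v∈X)

    mem-vecs : ∀ cs → mem X (lincomb cs vecs)
    mem-vecs = mem-lincomb X vecs inX

    -- Membership is an arbitrary predicate; the basis makes it decidable by a finite search for
    -- coefficients.
    mem? : ∀ v → Dec (mem X v)
    mem? v = map′ (λ { (cs , refl) → mem-vecs cs }) (spans v) (finite-any? (vector↔ k) λ cs → lincomb cs vecs ≟ᵥ v)

    ⊆-or-witness : ∀ (Y : Subspace n) → (∀ v → Dec (mem Y v)) → X ⊆ Y ⊎ ∃ λ v → mem X v × ¬ mem Y v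
    ⊆-or-witness Y Y? with any? (λ i → ¬? (Y? (lookup vecs i)))
    ... | yes (i , ∉) = inj₂ (_ , inX i , ∉)
    ... | no  none    = inj₁ λ v v∈X → subst (mem Y) (lincomb-coords v∈X) (mem-lincomb Y vecs all∈ (coords v∈X))
      where
      all∈ : ∀ i → mem Y (lookup vecs i)
      all∈ i with Y? (lookup vecs i)
      ... | yes ∈Y = ∈Y
      ... | no  ∉Y = ⊥-elim (none (i , ∉Y))

    transport : ∀ {Y} → X ≐ Y → Basis Y k
    transport (X⊆Y , Y⊆X) = record
      { vecs = vecs ; inX = λ i → X⊆Y _ (inX i) ; indep = indep ; spans = λ v v∈Y → spans v (Y⊆X v v∈Y) }

  Basis-≤ : ∀ {n k l} {X Y : Subspace n} → Basis X k → Basis Y l → X ⊆ Y → k ≤ l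
  Basis-≤ {k = k} {l} bX bY X⊆Y = injection⇒≤ f inj
    where
    open Basis bX
    f : Vector k → Vector l
    f cs = coords bY (X⊆Y _ (mem-vecs bX cs))
    inj : ∀ {cs ds} → f cs ≡ f ds → cs ≡ ds
    inj {cs} {ds} eq = lincomb-injective vecs indep (trans (sym (lincomb-coords bY _))
      (trans (cong (λ es → lincomb es (Basis.vecs bY)) eq) (lincomb-coords bY _)))

  extend-independent : ∀ {n k} {X : Subspace n} (bX : Basis X k) {v} → ¬ mem X v → Independent (v ∷ Basis.vecs bX)
  extend-independent {X = X} bX {v} v∉X (c ∷ cs) eq with c ≟ 0#
  ... | yes refl = cong (0# ∷_) (Basis.indep bX cs (trans (sym (+ᵥ-identityˡ _))
                     (trans (cong (_+ᵥ _) (sym (·ᵥ-zeroˡ v))) eq)))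
  ... | no c≢0 with inverse c c≢0
  ...   | d , cd≡1 = ⊥-elim (v∉X (subst (mem X) v≡ (mem-· X (- d) (mem-vecs bX cs))))
    where
    open ≡-Reasoning
    w = lincomb cs (Basis.vecs bX)
    v≡ : (- d) ·ᵥ w ≡ v
    v≡ = sym (difference-zero v ((- d) ·ᵥ w) (begin
      (- 1#) ·ᵥ (- d) ·ᵥ w +ᵥ v           ≡⟨ cong₂ _+ᵥ_ (sym (·ᵥ-assoc (- 1#) (- d) w)) (sym (·ᵥ-identity v)) ⟩
      ((- 1#) * (- d)) ·ᵥ w +ᵥ 1# ·ᵥ v    ≡⟨ cong₂ (λ x y → x ·ᵥ w +ᵥ y ·ᵥ v) neg-neg (trans (sym cd≡1) (*-comm c d)) ⟩
      d ·ᵥ w +ᵥ (d * c) ·ᵥ v              ≡⟨ cong (d ·ᵥ w +ᵥ_) (·ᵥ-assoc d c v) ⟩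
      d ·ᵥ w +ᵥ d ·ᵥ c ·ᵥ v               ≡⟨ ·ᵥ-distribˡ d w _ ⟨
      d ·ᵥ (w +ᵥ c ·ᵥ v)                  ≡⟨ cong (d ·ᵥ_) (trans (+ᵥ-comm w _) eq) ⟩
      d ·ᵥ zeroV                          ≡⟨ ·ᵥ-zeroʳ d ⟩
      zeroV                               ∎))
      where
      ring : Ring 0ℓ 0ℓ
      ring = CommutativeRing.ring (record { isCommutativeRing = isCommutativeRing })
      open RingProperties ring using (-1*x≈-x; -‿involutive)
      neg-neg : (- 1#) * (- d) ≡ d
      neg-neg = trans (-1*x≈-x (- d)) (-‿involutive d)

  extend : ∀ {n k} (X : BElt n k) {v} → ¬ mem (proj₁ X) v → BElt n (suc k)
  extend (X , bX) {v} v∉X = span (v ∷ Basis.vecs bX) , span-basis _ (extend-independent bX v∉X)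

  module _ {n k} (X : BElt n k) {v} (v∉X : ¬ mem (proj₁ X) v) where

    extend-⊇ : proj₁ X ⊆ proj₁ (extend X v∉X)
    extend-⊇ u u∈X = 0# ∷ coords (proj₂ X) u∈X ,
      trans (cong₂ _+ᵥ_ (·ᵥ-zeroˡ v) (lincomb-coords (proj₂ X) u∈X)) (+ᵥ-identityˡ u)

    extend-∋ : mem (proj₁ (extend X v∉X)) v
    extend-∋ = unit zero , lincomb-unit (v ∷ Basis.vecs (proj₂ X)) zero

    extend-⊆ : ∀ Y → proj₁ X ⊆ Y → mem Y v → proj₁ (extend X v∉X) ⊆ Y
    extend-⊆ Y X⊆Y v∈Y = span-⊆ Y _ λ { zero → v∈Y ; (suc i) → X⊆Y _ (Basis.inX (proj₂ X) i) }

  -- A vector of Y outside X would extend X to a space of dimension k + 1 inside Y.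
  ⊆-equal-dim : ∀ {n k} (X Y : BElt n k) → proj₁ X ⊆ proj₁ Y → proj₁ Y ⊆ proj₁ X
  ⊆-equal-dim (X , bX) (Y , bY) X⊆Y with ⊆-or-witness bY X (mem? bX)
  ... | inj₁ Y⊆X = Y⊆X
  ... | inj₂ (v , v∈Y , v∉X) = ⊥-elim (ℕ.1+n≰n (Basis-≤ (proj₂ (extend (X , bX) v∉X)) bY
                                 (extend-⊆ (X , bX) v∉X Y X⊆Y v∈Y)))

  extend-≐ : ∀ {n k} (X : BElt n k) (Y : BElt n (suc k)) {v} (v∉X : ¬ mem (proj₁ X) v) →
             proj₁ X ⊆ proj₁ Y → mem (proj₁ Y) v → proj₁ (extend X v∉X) ≐ proj₁ Y
  extend-≐ X Y v∉X X⊆Y v∈Y = ⊆ , ⊆-equal-dim (extend X v∉X) Y ⊆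
    where ⊆ = extend-⊆ X v∉X (proj₁ Y) X⊆Y v∈Y

  ≐-trans : ∀ {n} (X Y Z : Subspace n) → X ≐ Y → Y ≐ Z → X ≐ Z
  ≐-trans X Y Z (p , p′) (r , r′) = (λ v → r v ∘ p v) , (λ v → p′ v ∘ r′ v)

  -- Both spaces are the span of Y and v, for dimension reasons. This drives uniqueness of common
  -- neighbours, adjacency and the count of spaces above Y.
  extend-determines : ∀ {n k} (Y : BElt n k) (X Z : BElt n (suc k)) {v} → ¬ mem (proj₁ Y) v →
                      proj₁ Y ⊆ proj₁ X → mem (proj₁ X) v → proj₁ Y ⊆ proj₁ Z → mem (proj₁ Z) v → proj₁ X ≐ proj₁ Z
  extend-determines Y X Z v∉Y Y⊆X v∈X Y⊆Z v∈Z with extend-≐ Y X v∉Y Y⊆X v∈X | extend-≐ Y Z v∉Y Y⊆Z v∈Z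
  ... | p , p′ | r , r′ = (λ u → r u ∘ p′ u) , (λ u → p u ∘ r′ u)

  ⊆? : ∀ {n k l} (X : BElt n k) (Y : BElt n l) → Dec (proj₁ X ⊆ proj₁ Y)
  ⊆? (X , bX) (Y , bY) with ⊆-or-witness bX Y (mem? bY)
  ... | inj₁ X⊆Y = yes X⊆Y
  ... | inj₂ (v , v∈X , v∉Y) = no λ X⊆Y → v∉Y (X⊆Y v v∈X)

  B-enumeration : ∀ n k → ∃ λ N → Inverse (B n k) (setoid (Fin N))
  B-enumeration n k = enumerate (B n k) (λ X Y → ⊆? X Y ×-dec ⊆? Y X)
    (candidate ∘ Inverse.from (tuples↔ n k)) λ (X , bX) →
      Inverse.to (tuples↔ n k) (Basis.vecs bX) ,
      (span (Basis.vecs bX) , span-basis _ (proj₁ (accepted (Basis.indep bX)))) ,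
      trans (cong candidate (Inverse.strictlyInverseʳ (tuples↔ n k) _)) (proj₂ (accepted (Basis.indep bX))) ,
      span-⊆ X _ (Basis.inX bX) , Basis.spans bX
    where
    candidate : Vec (Vector n) k → Maybe (BElt n k)
    candidate bs with independent? bs
    ... | yes indep = just (span bs , span-basis bs indep)
    ... | no  _     = nothing

    -- The proof stored by `candidate` is the one found by `independent?`, which need not be the
    -- given one, so it is returned existentially.
    accepted : ∀ {bs} → Independent bs → ∃ λ indep → candidate bs ≡ just (span bs , span-basis bs indep)
    accepted {bs} indep with independent? bs
    ... | yes indep′ = indep′ , refl
    ... | no  dep    = ⊥-elim (dep indep)

  Basis-≤n : ∀ {n k} {X : Subspace n} → Basis X k → k ≤ n
  Basis-≤n bX = injection⇒≤ (λ cs → lincomb cs (Basis.vecs bX)) (lincomb-injective _ (Basis.indep bX))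

  outside : ∀ {n k} {X : Subspace n} → Basis X k → k < n → ∃ λ v → ¬ mem X v
  outside {n} {k} {X} bX k<n with finite-any? (vector↔ n) (λ v → ¬? (mem? bX v))
  ... | yes found = found
  ... | no  none  = ⊥-elim (ℕ.<⇒≱ k<n (injection⇒≤ (λ v → coords bX (all∈ v)) λ {u} {v} eq →
      trans (sym (lincomb-coords bX (all∈ u)))
        (trans (cong (λ cs → lincomb cs (Basis.vecs bX)) eq) (lincomb-coords bX (all∈ v)))))
    where
    all∈ : ∀ v → mem X v
    all∈ v with mem? bX v
    ... | yes v∈X = v∈X
    ... | no  v∉X = ⊥-elim (none (v , v∉X))

  origin : ∀ n → BElt n 0
  origin n = span [] , span-basis [] λ { [] _ → refl }

  B-inhabited : ∀ {n k} → k ≤ n → BElt n k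
  B-inhabited {n} {zero}  _   = origin n
  B-inhabited {n} {suc k} k<n with B-inhabited (ℕ.<⇒≤ k<n)
  ... | X = extend X (proj₂ (outside (proj₂ X) k<n))

  -- Greedy construction: keep adding vectors of X outside the current span.
  decidable-basis : ∀ {n} (X : Subspace n) → (∀ v → Dec (mem X v)) → ∃ (Basis X)
  decidable-basis {n} X X? = grow (suc n) (origin n) (span-⊆ X [] λ ()) (ℕ.+-identityʳ (suc n))
    where
    grow : ∀ fuel {k} (Y : BElt n k) → proj₁ Y ⊆ X → fuel ℕ.+ k ≡ suc n → ∃ (Basis X)
    -- With the fuel used up, Y would have dimension n + 1 in a space of dimension n.
    grow zero       (_ , bY) Y⊆X refl = ⊥-elim (ℕ.1+n≰n (Basis-≤n bY))
    grow (suc fuel) (Y , bY) Y⊆X eq with finite-any? (vector↔ n) (λ v → X? v ×-dec ¬? (mem? bY v))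
    ... | yes (v , v∈X , v∉Y) = grow fuel (extend (Y , bY) v∉Y) (extend-⊆ (Y , bY) v∉Y X Y⊆X v∈X)
                                  (trans (ℕ.+-suc fuel _) eq)
    ... | no none = _ , transport bY (Y⊆X , X⊆Y)
      where
      X⊆Y : X ⊆ Y
      X⊆Y v v∈X with mem? bY v
      ... | yes v∈Y = v∈Y
      ... | no  v∉Y = ⊥-elim (none (v , v∈X , v∉Y))

  -- Incidence of subspaces and adjacency in the Grassmann graph.

  ≐-or-witness : ∀ {n k} (X Y : BElt n k) →
                 proj₁ X ≐ proj₁ Y ⊎ ∃ λ v → mem (proj₁ X) v × ¬ mem (proj₁ Y) v
  ≐-or-witness X@(_ , bX) Y@(_ , bY) with ⊆-or-witness bX (proj₁ Y) (mem? bY)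
  ... | inj₁ X⊆Y = inj₁ (X⊆Y , ⊆-equal-dim X Y X⊆Y)
  ... | inj₂ w   = inj₂ w

  partial-linear : ∀ {n k} (Y Y′ : BElt n k) (X Z : BElt n (suc k)) →
                   proj₁ Y ⊆ proj₁ X → proj₁ Y′ ⊆ proj₁ X → proj₁ Y ⊆ proj₁ Z → proj₁ Y′ ⊆ proj₁ Z →
                   proj₁ Y′ ≐ proj₁ Y ⊎ proj₁ X ≐ proj₁ Z
  partial-linear Y Y′ X Z Y⊆X Y′⊆X Y⊆Z Y′⊆Z with ≐-or-witness Y′ Y
  ... | inj₁ eq = inj₁ eq
  ... | inj₂ (v , v∈Y′ , v∉Y) = inj₂ (extend-determines Y X Z v∉Y Y⊆X (Y′⊆X v v∈Y′) Y⊆Z (Y′⊆Z v v∈Y′))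

  GrassAdj-≢ : ∀ {n k} (X Z : BElt n k) → GrassAdj n k X Z → ¬ proj₁ X ≐ proj₁ Z
  GrassAdj-≢ (X , bX) (Z , bZ) (j , refl , bXZ) (X⊆Z , _) =
    ℕ.1+n≰n (Basis-≤ bX bXZ λ v v∈X → v∈X , X⊆Z v v∈X)

  GrassAdj-below : ∀ {n k} (X Z : BElt n (suc k)) → GrassAdj n (suc k) X Z →
                   Σ (BElt n k) λ Y → proj₁ Y ⊆ proj₁ X × proj₁ Y ⊆ proj₁ Z
  GrassAdj-below (X , _) (Z , _) (j , refl , bXZ) = (X ∩ Z , bXZ) , (λ _ → proj₁) , (λ _ → proj₂)

  -- A vector of the intersection outside Y would, together with Y, span both X and Z, which are
  -- distinct; so Y is the intersection.
  below-GrassAdj : ∀ {n k} (X Z : BElt n (suc k)) → ¬ proj₁ X ≐ proj₁ Z → (Y : BElt n k) →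
                   proj₁ Y ⊆ proj₁ X → proj₁ Y ⊆ proj₁ Z → GrassAdj n (suc k) X Z
  below-GrassAdj {k = k} X Z X≢Z Y Y⊆X Y⊆Z = k , refl ,
    transport (proj₂ Y) ((λ v v∈Y → Y⊆X v v∈Y , Y⊆Z v v∈Y) , meet⊆Y)
    where
    meet⊆Y : (proj₁ X ∩ proj₁ Z) ⊆ proj₁ Y
    meet⊆Y v (v∈X , v∈Z) with mem? (proj₂ Y) v
    ... | yes v∈Y = v∈Y
    ... | no  v∉Y = ⊥-elim (X≢Z (extend-determines Y X Z v∉Y Y⊆X v∈X Y⊆Z v∈Z))

  -- For v in Z outside X, the span of X and v contains Z, because Z is spanned by v and its
  -- hyperplane X ∩ Z.
  GrassAdj-above : ∀ {n k} (X Z : BElt n k) → GrassAdj n k X Z →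
                   Σ (BElt n (suc k)) λ Y → proj₁ X ⊆ proj₁ Y × proj₁ Z ⊆ proj₁ Y
  GrassAdj-above X Z adj@(j , refl , bXZ) with ≐-or-witness Z X
  ... | inj₁ (Z⊆X , X⊆Z) = ⊥-elim (GrassAdj-≢ X Z adj (X⊆Z , Z⊆X))
  ... | inj₂ (v , v∈Z , v∉X) = extend X v∉X , extend-⊇ X v∉X ,
    λ u u∈Z → extend-⊆ C v∉C (proj₁ (extend X v∉X)) (λ w w∈C → extend-⊇ X v∉X w (proj₁ w∈C)) (extend-∋ X v∉X)
                u (proj₂ (extend-≐ C Z v∉C (λ _ → proj₂) v∈Z) u u∈Z)
    where
    C = proj₁ X ∩ proj₁ Z , bXZ
    v∉C : ¬ mem (proj₁ C) v
    v∉C = v∉X ∘ proj₁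

  -- The dimension j of X ∩ Z is not known in advance, so a basis is first constructed. For v in X
  -- outside Z, the space Y is spanned by Z and v; writing x in X as c v + z puts z into X ∩ Z.
  -- Hence X is spanned by X ∩ Z and v, and j + 1 = k.
  above-GrassAdj : ∀ {n k} (X Z : BElt n k) → ¬ proj₁ X ≐ proj₁ Z → (Y : BElt n (suc k)) →
                   proj₁ X ⊆ proj₁ Y → proj₁ Z ⊆ proj₁ Y → GrassAdj n k X Z
  above-GrassAdj {n} {k} X Z X≢Z Y X⊆Y Z⊆Y with ≐-or-witness X Z
  ... | inj₁ eq = ⊥-elim (X≢Z eq)
  ... | inj₂ (v , v∈X , v∉Z) = j , ℕ.≤-antisym (Basis-≤ (proj₂ (extend C v∉C)) (proj₂ X) CV⊆X)
                                               (Basis-≤ (proj₂ X) (proj₂ (extend C v∉C)) X⊆CV) , proj₂ meet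
    where
    meet = decidable-basis (proj₁ X ∩ proj₁ Z) λ u → mem? (proj₂ X) u ×-dec mem? (proj₂ Z) u
    j = proj₁ meet
    C : BElt n j
    C = proj₁ X ∩ proj₁ Z , proj₂ meet
    v∉C : ¬ mem (proj₁ C) v
    v∉C = v∉Z ∘ proj₂
    CV⊆X : proj₁ (extend C v∉C) ⊆ proj₁ X
    CV⊆X = extend-⊆ C v∉C (proj₁ X) (λ _ → proj₁) v∈X
    X⊆CV : proj₁ X ⊆ proj₁ (extend C v∉C)
    X⊆CV x x∈X with proj₂ (extend-≐ Z Y v∉Z Z⊆Y (X⊆Y v v∈X)) x (X⊆Y x x∈X)
    ... | c ∷ cs , eq = subst (mem (proj₁ (extend C v∉C))) eq
      (mem-+ (proj₁ (extend C v∉C)) (mem-· (proj₁ (extend C v∉C)) c (extend-∋ C v∉C))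
                                    (extend-⊇ C v∉C z (z∈X , mem-vecs (proj₂ Z) cs)))
      where
      z = lincomb cs (Basis.vecs (proj₂ Z))
      z∈X : mem (proj₁ X) z
      z∈X = subst (mem (proj₁ X)) (sym (move c v z eq)) (mem-+ (proj₁ X) (mem-· (proj₁ X) (- c) v∈X) x∈X)

  module Coordinates {n k} (X̂ : BElt n k) where
    private
      X  = proj₁ X̂
      bX = proj₂ X̂
      bs = Basis.vecs bX
      L : Vector k → Vector n
      L cs = lincomb cs bs
      L-injective : ∀ {cs ds} → L cs ≡ L ds → cs ≡ ds
      L-injective = lincomb-injective bs (Basis.indep bX)

    pull : ∀ {l} → Σ (BElt n l) (λ Y → proj₁ Y ⊆ X) → BElt k l
    pull {l} ((Y , bY) , Y⊆X) = Y′ , record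
      { vecs  = ws
      ; inX   = λ i → subst (mem Y) (sym (L-ws i)) (Basis.inX bY i)
      ; indep = λ ds eq → Basis.indep bY ds (trans (via-L ds) (trans (cong L eq) (lincomb-0 bs)))
      ; spans = λ cs cs∈ → coords bY cs∈ , L-injective (trans (sym (via-L (coords bY cs∈))) (lincomb-coords bY cs∈))
      }
      where
      Y′ : Subspace k
      Y′ = record
        { mem      = λ cs → mem Y (L cs)
        ; mem-zero = subst (mem Y) (sym (lincomb-0 bs)) (mem-zero Y)
        ; mem-+    = λ {cs} {ds} p r → subst (mem Y) (sym (lincomb-+ cs ds bs)) (mem-+ Y p r)
        ; mem-·    = λ c {cs} p → subst (mem Y) (sym (lincomb-· c cs bs)) (mem-· Y c p)
        }

      w : Fin l → Vector k
      w i = coords bX (Y⊆X _ (Basis.inX bY i))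

      ws : Vec (Vector k) l
      ws = tabulate w

      L-ws : ∀ i → L (lookup ws i) ≡ lookup (Basis.vecs bY) i
      L-ws i = trans (cong L (lookup∘tabulate w i)) (lincomb-coords bX (Y⊆X _ (Basis.inX bY i)))

      map-ws : map L ws ≡ Basis.vecs bY
      map-ws = trans (sym (tabulate∘lookup _)) (trans (tabulate-cong λ i → trans (lookup-map i L ws) (L-ws i)) (tabulate∘lookup _))

      via-L : ∀ ds → lincomb ds (Basis.vecs bY) ≡ L (lincomb ds ws)
      via-L ds = trans (cong (lincomb ds) (sym map-ws)) (lincomb-map ds ws bs)

    push : ∀ {l} → BElt k l → Σ (BElt n l) (λ Y → proj₁ Y ⊆ X)
    push (W , bW) = (Y , record
      { vecs  = map L (Basis.vecs bW)
      ; inX   = λ i → _ , sym (lookup-map i L (Basis.vecs bW)) , Basis.inX bW i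
      ; indep = λ ds eq → Basis.indep bW ds (L-injective (trans (sym (lincomb-map ds (Basis.vecs bW) bs)) (trans eq (sym (lincomb-0 bs)))))
      ; spans = λ { _ (cs , refl , cs∈W) → coords bW cs∈W ,
                    trans (lincomb-map (coords bW cs∈W) (Basis.vecs bW) bs) (cong L (lincomb-coords bW cs∈W)) }
      }) , λ { _ (cs , refl , _) → mem-vecs bX cs }
      where
      Y : Subspace n
      Y = record
        { mem      = λ v → ∃ λ cs → L cs ≡ v × mem W cs
        ; mem-zero = zeroV , lincomb-0 bs , mem-zero W
        ; mem-+    = λ { (cs , refl , p) (ds , refl , r) → cs +ᵥ ds , lincomb-+ cs ds bs , mem-+ W p r }
        ; mem-·    = λ { c (cs , refl , p) → c ·ᵥ cs , lincomb-· c cs bs , mem-· W c p }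
        }

    -- Coordinates with respect to a basis of X turn the subspaces of X into those of the standard
    -- space of the same dimension, so their number does not depend on X.
    subspaces-≅ : ∀ l → Inverse (subsetoid (B n l) (λ Y → proj₁ Y ⊆ X)) (B k l)
    subspaces-≅ l = record
      { to        = pull
      ; from      = push
      ; to-cong   = λ {x} {y} → pull-cong {x} {y}
      ; from-cong = λ {x} {y} → push-cong {x} {y}
      ; inverse   = (λ {x} {y} eq → ≐-trans (proj₁ (pull y)) (proj₁ (pull (push x))) (proj₁ x) (pull-cong {y} {push x} eq) (pull-push x))
                  , (λ {x} {y} eq → ≐-trans (proj₁ (proj₁ (push y))) (proj₁ (proj₁ (push (pull x)))) (proj₁ (proj₁ x)) (push-cong {y} {pull x} eq) (push-pull x))
      }
      where
      Sub = Σ (BElt n l) (λ Y → proj₁ Y ⊆ X)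

      pull-cong : ∀ {x y : Sub} → proj₁ (proj₁ x) ≐ proj₁ (proj₁ y) → proj₁ (pull x) ≐ proj₁ (pull y)
      pull-cong (p , p′) = (λ cs → p (L cs)) , (λ cs → p′ (L cs))

      push-cong : ∀ {x y : BElt k l} → proj₁ x ≐ proj₁ y → proj₁ (proj₁ (push x)) ≐ proj₁ (proj₁ (push y))
      push-cong (p , p′) = (λ { v (cs , eq , cs∈) → cs , eq , p cs cs∈ }) , (λ { v (cs , eq , cs∈) → cs , eq , p′ cs cs∈ })

      pull-push : ∀ x → proj₁ (pull (push x)) ≐ proj₁ x
      pull-push (W , _) = (λ { cs (ds , eq , ds∈W) → subst (mem W) (L-injective eq) ds∈W }) , (λ cs cs∈W → cs , refl , cs∈W)

      push-pull : ∀ x → proj₁ (proj₁ (push (pull x))) ≐ proj₁ (proj₁ x)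
      push-pull ((Y , _) , Y⊆X) = (λ { v (cs , refl , v∈Y) → v∈Y })
        , (λ v v∈Y → coords bX (Y⊆X v v∈Y) , lincomb-coords bX (Y⊆X v v∈Y)
                   , subst (mem Y) (sym (lincomb-coords bX (Y⊆X v v∈Y))) v∈Y)

-- Subsets and pairs described by Boolean predicates.

∃-true-≡ : ∀ {A : Set} {P : A → Bool} {x y : Σ A λ a → P a ≡ true} → proj₁ x ≡ proj₁ y → x ≡ y
∃-true-≡ {x = a , p} {.a , r} refl = cong (a ,_) (Decidable⇒UIP.≡-irrelevant Bool._≟_ p r)

subsetoid-dec : ∀ {A : Set} {Q : A → Set} (Q? : ∀ a → Dec (Q a)) →
                Inverse (subsetoid (setoid A) Q) (setoid (Σ A λ a → does (Q? a) ≡ true))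
subsetoid-dec Q? = record
  { to        = λ (a , p) → a , dec-true (Q? a) p
  ; from      = λ (a , p) → a , does-sound (Q? a) p
  ; to-cong   = λ eq → ∃-true-≡ eq
  ; from-cong = λ { refl → refl }
  ; inverse   = (λ eq → ∃-true-≡ eq) , (λ { refl → refl })
  }

module _ {a ℓ} {S : Setoid a ℓ} {N} (idx : Inverse S (setoid (Fin N)))
  {Q : Setoid.Carrier S → Set} (Q? : Fin N → Bool)
  (Q-true : ∀ {s} → Q s → Q? (Inverse.to idx s) ≡ true)
  (Q-sound : ∀ {i} → Q? i ≡ true → Q (Inverse.from idx i)) where
  open Inverse idx

  subsetoid-≅ : Inverse (subsetoid S Q) (setoid (Σ (Fin N) λ i → Q? i ≡ true))
  subsetoid-≅ = record
    { to        = λ (s , p) → to s , Q-true p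
    ; from      = λ (i , p) → from i , Q-sound p
    ; to-cong   = λ eq → ∃-true-≡ (to-cong eq)
    ; from-cong = λ { refl → Setoid.refl S }
    ; inverse   = (λ eq → ∃-true-≡ (inverseˡ eq)) , (λ { refl → inverseʳ refl })
    }

  module _ {b ℓ′} {T : Setoid b ℓ′} {M} (idx′ : Inverse T (setoid (Fin M)))
    {R : Setoid.Carrier S → Setoid.Carrier T → Set} (R? : Fin N → Fin M → Bool)
    (R-true : ∀ {s t} → R s t → R? (to s) (Inverse.to idx′ t) ≡ true)
    (R-sound : ∀ {i j} → R? i j ≡ true → R (from i) (Inverse.from idx′ j)) where
    private module T = Inverse idx′

    pair-subsetoid-≅ : Inverse (subsetoid (×-setoid S T) (λ (s , t) → Q s × R s t))
      (setoid (Σ (Σ (Fin N) λ i → Q? i ≡ true) λ (i , _) → Σ (Fin M) λ j → R? i j ≡ true))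
    pair-subsetoid-≅ = record
      { to        = λ ((s , t) , p , r) → (to s , Q-true p) , T.to t , R-true r
      ; from      = λ ((i , p) , j , r) → (from i , T.from j) , Q-sound p , R-sound r
      ; to-cong   = λ (eq , eq′) → pairs-≡ (to-cong eq) (T.to-cong eq′)
      ; from-cong = λ { refl → Setoid.refl S , Setoid.refl T }
      ; inverse   = (λ (eq , eq′) → pairs-≡ (inverseˡ eq) (T.inverseˡ eq′))
                  , (λ { refl → inverseʳ refl , T.inverseʳ refl })
      }
      where
      pairs-≡ : ∀ {i i′ j j′ p p′ r r′} → i ≡ i′ → j ≡ j′ →
                _≡_ {A = Σ (Σ (Fin N) λ i → Q? i ≡ true) λ (i , _) → Σ (Fin M) λ j → R? i j ≡ true}
                    ((i , p) , j , r) ((i′ , p′) , j′ , r′)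
      pairs-≡ {p = p} {p′} {r} {r′} refl refl
        rewrite Decidable⇒UIP.≡-irrelevant Bool._≟_ p p′ | Decidable⇒UIP.≡-irrelevant Bool._≟_ r r′ = refl

inhabited-size : ∀ {a ℓ} {S : Setoid a ℓ} → Setoid.Carrier S → (∃ λ N → Inverse S (setoid (Fin N))) →
                 ∃ λ N → Inverse S (setoid (Fin (suc N)))
inhabited-size s (suc N , f) = N , f
inhabited-size s (zero , f) with Inverse.to f s
... | ()

sum-ones : ∀ n → sum {n} (λ _ → 1) ≡ n
sum-ones zero    = ℕΣ.sum-empty (λ _ → 1)
sum-ones (suc n) = trans (ℕΣ.sum-suc {n} (λ _ → 1)) (cong suc (sum-ones n))

indicator-true : ∀ {b} → b ≡ true → indicator b ≡ 1
indicator-true refl = refl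

indicator-false : ∀ {b} → ¬ b ≡ true → indicator b ≡ 0
indicator-false {true}  ¬t = ⊥-elim (¬t refl)
indicator-false {false} ¬t = refl

-- Degrees of the Grassmann incidence and the final bijection.

module Grassmannian (F : FiniteField) (n k : ℕ) (k<n : k < n) {p r : ℕ} where
  open LinearAlgebra F
  open Subspaces F

  module Indexed (idxP : Inverse (B n k) (setoid (Fin (suc p))))
                 (idxQ : Inverse (B n (suc k)) (setoid (Fin (suc r)))) where
    module P = Inverse idxP
    module Q = Inverse idxQ

    repP : Fin (suc p) → BElt n k
    repP = P.from

    repQ : Fin (suc r) → BElt n (suc k)
    repQ = Q.from

    abstract
      inc : Fin (suc p) → Fin (suc r) → Bool
      inc i j = does (⊆? (repP i) (repQ j))

      inc-sound : ∀ {i j} → inc i j ≡ true → proj₁ (repP i) ⊆ proj₁ (repQ j)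
      inc-sound {i} {j} = does-sound (⊆? (repP i) (repQ j))

      inc-true : ∀ {Y X} → proj₁ Y ⊆ proj₁ X → inc (P.to Y) (Q.to X) ≡ true
      inc-true {Y} {X} Y⊆X = dec-true (⊆? (repP (P.to Y)) (repQ (Q.to X))) λ v v∈ →
        proj₂ (Q.strictlyInverseʳ X) v (Y⊆X v (proj₁ (P.strictlyInverseʳ Y) v v∈))

    inc-rep : ∀ {i j} → proj₁ (repP i) ⊆ proj₁ (repQ j) → inc i j ≡ true
    inc-rep {i} {j} i⊆j = subst₂ (λ i j → inc i j ≡ true) (P.strictlyInverseˡ i) (Q.strictlyInverseˡ j)
      (inc-true {repP i} {repQ j} i⊆j)

    P-injective : ∀ {X Y} → P.to X ≡ P.to Y → proj₁ X ≐ proj₁ Y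
    P-injective {X} {Y} eq = Setoid.trans (B n k) {X} {repP (P.to Y)} {Y}
      (Setoid.sym (B n k) {repP (P.to Y)} {X} (P.inverseʳ (sym eq))) (P.strictlyInverseʳ Y)

    Q-injective : ∀ {X Y} → Q.to X ≡ Q.to Y → proj₁ X ≐ proj₁ Y
    Q-injective {X} {Y} eq = Setoid.trans (B n (suc k)) {X} {repQ (Q.to Y)} {Y}
      (Setoid.sym (B n (suc k)) {repQ (Q.to Y)} {X} (Q.inverseʳ (sym eq))) (Q.strictlyInverseʳ Y)

    repP-injective : ∀ {i i′} → proj₁ (repP i) ≐ proj₁ (repP i′) → i ≡ i′
    repP-injective {i} {i′} eq = trans (sym (P.strictlyInverseˡ i)) (P.inverseˡ eq)

    repQ-injective : ∀ {j j′} → proj₁ (repQ j) ≐ proj₁ (repQ j′) → j ≡ j′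
    repQ-injective {j} {j′} eq = trans (sym (Q.strictlyInverseˡ j)) (Q.inverseˡ eq)

    linear : ∀ {i i′ j j′} → inc i j ≡ true → inc i′ j ≡ true → inc i j′ ≡ true → inc i′ j′ ≡ true → i ≡ i′ ⊎ j ≡ j′
    linear {i} {i′} {j} {j′} ij i′j ij′ i′j′
      with partial-linear (repP i′) (repP i) (repQ j) (repQ j′) (inc-sound i′j) (inc-sound ij) (inc-sound i′j′) (inc-sound ij′)
    ... | inj₁ eq = inj₁ (repP-injective eq)
    ... | inj₂ eq = inj₂ (repQ-injective eq)

    at-inc : ∀ {Y j} → proj₁ Y ⊆ proj₁ (repQ j) → inc (P.to Y) j ≡ true
    at-inc {Y} {j} Y⊆j = subst (λ j → inc (P.to Y) j ≡ true) (Q.strictlyInverseˡ j) (inc-true {Y} {repQ j} Y⊆j)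

    b : ℕ
    b = proj₁ (B-enumeration (suc k) k)

    below↔ : ∀ j → (Σ (Fin (suc p)) λ i → inc i j ≡ true) ↔ Fin b
    below↔ j = Compose.inverse
      (Symmetry.inverse (subsetoid-≅ idxP (λ i → inc i j)
        (λ {Y} → at-inc {Y})
        (λ {i} → inc-sound {i} {j})))
      (Compose.inverse (Coordinates.subspaces-≅ (repQ j) k) (proj₂ (B-enumeration (suc k) k)))

    degQ : ∀ j → sum (λ i → indicator (inc i j)) ≡ b
    degQ j = subset-size (λ i → inc i j) (below↔ j)

    instance
      b-nonZero : ℕ.NonZero b
      b-nonZero = ℕ.>-nonZero (fin-positive (Inverse.to (proj₂ (B-enumeration (suc k) k)) (B-inhabited (ℕ.n≤1+n k))))
        where
        fin-positive : ∀ {n} → Fin n → 0 < n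
        fin-positive zero    = s≤s z≤n
        fin-positive (suc _) = s≤s z≤n

    vec : Fin (q ℕ.^ n) → Vector n
    vec = Inverse.from (vector↔ n)

    abstract
      has : ∀ {l} → BElt n l → Fin (q ℕ.^ n) → Bool
      has (X , bX) v = does (mem? bX (vec v))

      has-sound : ∀ {l} (X : BElt n l) {v} → has X v ≡ true → mem (proj₁ X) (vec v)
      has-sound (X , bX) = does-sound (mem? bX _)

      has-true : ∀ {l} (X : BElt n l) {v} → mem (proj₁ X) (vec v) → has X v ≡ true
      has-true (X , bX) = dec-true (mem? bX _)

    points↔ : ∀ {l} (X : BElt n l) → (Σ (Fin (q ℕ.^ n)) λ v → has X v ≡ true) ↔ Vector l
    points↔ X@(_ , bX) = mk↔ₛ′ (λ (v , v∈) → coords bX (has-sound X v∈)) (λ cs → code cs , code∈ cs)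
      (λ cs → lincomb-injective bs (Basis.indep bX) (trans (lincomb-coords bX _) (vec-code cs)))
      (λ (v , v∈) → ∃-true-≡ (trans (cong (Inverse.to (vector↔ n)) (lincomb-coords bX (has-sound X v∈)))
                                    (Inverse.strictlyInverseˡ (vector↔ n) v)))
      where
      bs = Basis.vecs bX
      code = λ cs → Inverse.to (vector↔ n) (lincomb cs bs)
      vec-code : ∀ cs → vec (code cs) ≡ lincomb cs bs
      vec-code cs = Inverse.strictlyInverseʳ (vector↔ n) (lincomb cs bs)
      code∈ : ∀ cs → has X (code cs) ≡ true
      code∈ cs = has-true X (subst (mem (proj₁ X)) (sym (vec-code cs)) (mem-vecs bX cs))

    points : ∀ {l} (X : BElt n l) → sum (indicator ∘ has X) ≡ q ℕ.^ l
    points {l} X = subset-size (has X) (↔-trans (points↔ X) (vector↔ l))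

    up : Fin (suc p) → ℕ
    up i = sum (λ j → indicator (inc i j))

    -- Each vector outside X lies in exactly one of the spaces of dimension k + 1 above X.
    above-point : ∀ i v → sum (λ j → indicator (inc i j) ℕ.* indicator (has (repQ j) v)) ℕ.+ indicator (has (repP i) v) ≡
                          1 ℕ.+ up i ℕ.* indicator (has (repP i) v)
    above-point i v with has (repP i) v in eq
    ... | true = trans (cong (ℕ._+ 1) (ℕΣ.sum-cong drop)) (trans (ℕ.+-comm (up i) 1) (cong suc (sym (ℕ.*-identityʳ (up i)))))
      where
      drop : ∀ j → indicator (inc i j) ℕ.* indicator (has (repQ j) v) ≡ indicator (inc i j)
      drop j with inc i j in ij
      ... | false = refl
      ... | true  = trans (ℕ.+-identityʳ _) (indicator-true (has-true (repQ j) (inc-sound ij _ (has-sound (repP i) eq))))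
    ... | false = begin
      sum f ℕ.+ 0       ≡⟨ ℕ.+-identityʳ _ ⟩
      sum f             ≡⟨ sum-at f j₀ others ⟩
      f j₀              ≡⟨ cong₂ ℕ._*_ (indicator-true i⊂j₀) (indicator-true v∈j₀) ⟩
      1                 ≡⟨ cong suc (ℕ.*-zeroʳ (up i)) ⟨
      1 ℕ.+ up i ℕ.* 0  ∎
      where
      open ≡-Reasoning
      f : Fin (suc r) → ℕ
      f j = indicator (inc i j) ℕ.* indicator (has (repQ j) v)
      X = repP i
      v∉X : ¬ mem (proj₁ X) (vec v)
      v∉X v∈X with trans (sym eq) (has-true X v∈X)
      ... | ()
      W = extend X v∉X
      j₀ = Q.to W
      W≐ : proj₁ (repQ j₀) ≐ proj₁ W
      W≐ = Q.strictlyInverseʳ W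
      i⊂j₀ : inc i j₀ ≡ true
      i⊂j₀ = inc-rep λ u u∈ → proj₂ W≐ u (extend-⊇ X v∉X u u∈)
      v∈j₀ : has (repQ j₀) v ≡ true
      v∈j₀ = has-true (repQ j₀) (proj₂ W≐ _ (extend-∋ X v∉X))
      others : ∀ j → j ≢ j₀ → f j ≡ 0
      others j j≢ with inc i j in ij
      ... | false = refl
      ... | true  = trans (ℕ.+-identityʳ _) (indicator-false λ v∈j → j≢ (repQ-injective
        (extend-determines X (repQ j) (repQ j₀) v∉X (inc-sound ij) (has-sound (repQ j) v∈j)
                           (inc-sound i⊂j₀) (has-sound (repQ j₀) v∈j₀))))

    -- Counts pairs of a vector and a space above X in two ways. This is up (q^(k+1) - q^k) = q^n -
    -- q^k without subtraction; it determines `up i` independently of i, so neither a quotient space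
    -- nor the value of `up` is required.
    point-count : ∀ i → up i ℕ.* q ℕ.^ suc k ℕ.+ q ℕ.^ k ≡ q ℕ.^ n ℕ.+ up i ℕ.* q ℕ.^ k
    point-count i = begin
      up i ℕ.* q ℕ.^ suc k ℕ.+ q ℕ.^ k
        ≡⟨ cong₂ ℕ._+_ (trans (ℕΣ.sum-* _ _) (ℕΣ.sum-cong λ j → trans (cong (indicator (inc i j) ℕ.*_) (sym (points (repQ j)))) (ℕΣ.*-sum (indicator (inc i j)) (indicator ∘ has (repQ j)))))
             (sym (points (repP i))) ⟩
      sum (λ j → sum λ v → indicator (inc i j) ℕ.* indicator (has (repQ j) v)) ℕ.+ sum (λ v → indicator (has (repP i) v))
        ≡⟨ trans (cong (ℕ._+ sum (indicator ∘ has (repP i))) (ℕΣ.sum-comm λ j v → indicator (inc i j) ℕ.* indicator (has (repQ j) v))) (sym (ℕΣ.sum-+ _ _)) ⟩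
      sum (λ v → sum (λ j → indicator (inc i j) ℕ.* indicator (has (repQ j) v)) ℕ.+ indicator (has (repP i) v))
        ≡⟨ ℕΣ.sum-cong (above-point i) ⟩
      sum (λ v → 1 ℕ.+ up i ℕ.* indicator (has (repP i) v))
        ≡⟨ ℕΣ.sum-+ _ _ ⟩
      sum (λ v → 1) ℕ.+ sum (λ v → up i ℕ.* indicator (has (repP i) v))
        ≡⟨ cong₂ ℕ._+_ (sum-ones _) (trans (sym (ℕΣ.*-sum (up i) (indicator ∘ has (repP i)))) (cong (up i ℕ.*_) (points (repP i)))) ⟩
      q ℕ.^ n ℕ.+ up i ℕ.* q ℕ.^ k ∎
      where open ≡-Reasoning

    -- The difference q^(k+1) - q^k as a successor, ready for cancellation.
    gap : ∃ λ e → q ℕ.^ suc k ≡ q ℕ.^ k ℕ.+ suc e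
    gap with ℕ.m≤n⇒∃[o]m+o≡n (ℕ.^-monoʳ-< q 1<q (ℕ.n<1+n k))
    ... | e , eq = e , trans (sym eq) (sym (ℕ.+-suc _ e))

    up-count : ∀ i → up i ℕ.* suc (proj₁ gap) ℕ.+ q ℕ.^ k ≡ q ℕ.^ n
    up-count i = ℕ.+-cancelʳ-≡ (up i ℕ.* q ℕ.^ k) _ _ (trans (rearrange (up i) (proj₁ gap) (q ℕ.^ k))
      (trans (cong (λ x → up i ℕ.* x ℕ.+ q ℕ.^ k) (sym (proj₂ gap))) (point-count i)))
      where
      rearrange : ∀ u e t → u ℕ.* suc e ℕ.+ t ℕ.+ u ℕ.* t ≡ u ℕ.* (t ℕ.+ suc e) ℕ.+ t
      rearrange = solve-∀

    a : ℕ
    a = up zero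

    degP : ∀ i → up i ≡ a
    degP i = ℕ.*-cancelʳ-≡ (up i) a (suc (proj₁ gap))
      (ℕ.+-cancelʳ-≡ (q ℕ.^ k) _ _ (trans (up-count i) (sym (up-count zero))))

    instance
      a-nonZero : ℕ.NonZero a
      -- For a = 0, `up-count` would say q ^ k = q ^ n, against k < n.
      a-nonZero = ℕ.≢-nonZero λ a≡0 → ℕ.<⇒≢ (ℕ.^-monoʳ-< q 1<q k<n)
        (trans (cong (λ u → u ℕ.* suc (proj₁ gap) ℕ.+ q ℕ.^ k) (sym a≡0)) (up-count zero))

    above↔ : ∀ i → (Σ (Fin (suc r)) λ j → inc i j ≡ true) ↔ Fin a
    above↔ i = subst (λ c → (Σ (Fin (suc r)) λ j → inc i j ≡ true) ↔ Fin c) (degP i) (subset↔Fin (inc i))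

    open Incidence inc a b using (adjP; adjQ; adjP-true; adjP-sound; adjQ-true; adjQ-sound; trees-ratio)

    T-Q : Inverse (SpanningTrees.RootedTrees (B n (suc k)) (GrassAdj n (suc k))) (setoid (Fin (treeCount adjQ)))
    T-Q = Compose.inverse (TreeVectors.rootedTrees↔treeVectors (B n (suc k)) (GrassAdj n (suc k)) idxQ adjQ adj adj⁻¹ adj-sym)
      (Compose.inverse (subsetoid-dec (isRootedTree? adjQ)) (vecSubset↔Fin λ v → does (isRootedTree? adjQ v)))
      where
      adj : ∀ X Z → GrassAdj n (suc k) X Z → Q.to X ≢ Q.to Z × adjQ (Q.to X) (Q.to Z) ≡ true
      adj X Z e with GrassAdj-below X Z e
      ... | Y , Y⊆X , Y⊆Z = (λ eq → GrassAdj-≢ X Z e (Q-injective {X} {Z} eq)) ,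
        adjQ-true (inc-true {Y} {X} Y⊆X) (inc-true {Y} {Z} Y⊆Z)

      adj⁻¹ : ∀ X Z → Q.to X ≢ Q.to Z → adjQ (Q.to X) (Q.to Z) ≡ true → GrassAdj n (suc k) X Z
      adj⁻¹ X Z X≢Z e with adjQ-sound e
      ... | i , iX , iZ = below-GrassAdj X Z (λ eq → X≢Z (Q.to-cong {X} {Z} eq)) (repP i)
        (λ v v∈ → proj₁ (Q.strictlyInverseʳ X) v (inc-sound iX v v∈))
        (λ v v∈ → proj₁ (Q.strictlyInverseʳ Z) v (inc-sound iZ v v∈))

      adj-sym : ∀ j j′ → adjQ j j′ ≡ true → adjQ j′ j ≡ true
      adj-sym j j′ e with adjQ-sound e
      ... | i , ij , ij′ = adjQ-true ij′ ij

    T-P : Inverse (SpanningTrees.RootedTrees (B n k) (GrassAdj n k)) (setoid (Fin (treeCount adjP)))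
    T-P = Compose.inverse (TreeVectors.rootedTrees↔treeVectors (B n k) (GrassAdj n k) idxP adjP adj adj⁻¹ adj-sym)
      (Compose.inverse (subsetoid-dec (isRootedTree? adjP)) (vecSubset↔Fin λ v → does (isRootedTree? adjP v)))
      where
      adj : ∀ X Z → GrassAdj n k X Z → P.to X ≢ P.to Z × adjP (P.to X) (P.to Z) ≡ true
      adj X Z e with GrassAdj-above X Z e
      ... | Y , X⊆Y , Z⊆Y = (λ eq → GrassAdj-≢ X Z e (P-injective {X} {Z} eq)) ,
        adjP-true (inc-true {X} {Y} X⊆Y) (inc-true {Z} {Y} Z⊆Y)

      adj⁻¹ : ∀ X Z → P.to X ≢ P.to Z → adjP (P.to X) (P.to Z) ≡ true → GrassAdj n k X Z
      adj⁻¹ X Z X≢Z e with adjP-sound e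
      ... | j , jX , jZ = above-GrassAdj X Z (λ eq → X≢Z (P.to-cong {X} {Z} eq)) (repQ j)
        (λ v v∈ → inc-sound jX v (proj₂ (P.strictlyInverseʳ X) v v∈))
        (λ v v∈ → inc-sound jZ v (proj₂ (P.strictlyInverseʳ Z) v v∈))

      adj-sym : ∀ i i′ → adjP i i′ ≡ true → adjP i′ i ≡ true
      adj-sym i i′ e with adjP-sound e
      ... | j , ij , i′j = adjP-true i′j ij

    inc-at : ∀ {i Z} → proj₁ (repP i) ⊆ proj₁ Z → inc i (Q.to Z) ≡ true
    inc-at {i} {Z} i⊆Z = subst (λ i → inc i (Q.to Z) ≡ true) (P.strictlyInverseˡ i) (inc-true {repP i} {Z} i⊆Z)

    -- There are b choices of Y below, then a choices of Z above Y. The product is commuted to have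
    -- the same form as in `DU-fibre`, where the choices come in the other order.
    UD-fibre : ∀ j → Inverse (subsetoid (×-setoid (B n k) (B n (suc k))) (UDRel n (suc k) (repQ j))) (setoid (Fin (a ℕ.* b)))
    UD-fibre j = Compose.inverse
      (pair-subsetoid-≅ idxP (λ i → inc i j) (λ {Y} → at-inc {Y}) inc-sound
                        idxQ inc (λ {Y} {Z} → inc-true {Y} {Z}) inc-sound)
      (subst (λ c → (Σ (Σ (Fin (suc p)) λ i → inc i j ≡ true) λ (i , _) → Σ (Fin (suc r)) λ j → inc i j ≡ true) ↔ Fin c)
             (ℕ.*-comm b a) (↔-trans (Σ-↔ (below↔ j) (λ {x} → above↔ (proj₁ x))) (↔-sym Fin.*↔×)))

    DU-fibre : ∀ i → Inverse (subsetoid (×-setoid (B n (suc k)) (B n k)) (DURel n (suc k) (repP i))) (setoid (Fin (a ℕ.* b)))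
    DU-fibre i = Compose.inverse
      (pair-subsetoid-≅ idxQ (inc i) (λ {Z} → inc-at {i} {Z}) inc-sound
                        idxP (λ j i → inc i j) (λ {Z} {Y} → inc-true {Y} {Z}) inc-sound)
      (↔-trans (Σ-↔ (above↔ i) (λ {x} → below↔ (proj₁ x))) (↔-sym Fin.*↔×))

    open Grassmann F using (T; ΠDU; ΠUD)

    left : Inverse (×-setoid (T n (suc k)) (ΠDU n (suc k))) (setoid (Fin (treeCount adjQ ℕ.* (a ℕ.* b) ℕ.^ suc p)))
    left = ×-≅Fin T-Q (ΠSetoid-≅Fin (B n k) (×-setoid (B n (suc k)) (B n k)) (DURel n (suc k))
      (λ (p , p′) (x , z) → (λ v v∈ → x v (p′ v v∈)) , z) idxP DU-fibre)

    right : Inverse (×-setoid (T n k) (ΠUD n (suc k))) (setoid (Fin (treeCount adjP ℕ.* (a ℕ.* b) ℕ.^ suc r)))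
    right = ×-≅Fin T-P (ΠSetoid-≅Fin (B n (suc k)) (×-setoid (B n k) (B n (suc k))) (UDRel n (suc k))
      (λ (p , p′) (x , z) → (λ v v∈ → p v (x v v∈)) , z) idxQ UD-fibre)

    conclusion : Inverse (×-setoid (T n (suc k)) (ΠDU n (suc k))) (×-setoid (T n k) (ΠUD n (suc k)))
    conclusion = Compose.inverse left (Symmetry.inverse
      (subst (λ c → Inverse (×-setoid (T n k) (ΠUD n (suc k))) (setoid (Fin c))) (sym (trees-ratio degP degQ linear)) right))

open import Data.Nat using (_*_)

theorem3p3 : (F : FiniteField) (n m : ℕ) → 1 ≤ m → 2 * m ≤ n →
    let open Grassmann F in
    Inverse (×-setoid (T n m) (ΠDU n m)) (×-setoid (T n (m ∸ 1)) (ΠUD n m))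
-- `P` and `Q` are indexed by `Fin (suc _)`, so a subspace of each of the dimensions k and k + 1 has
-- to be exhibited.
theorem3p3 F n (suc k) _ 2m≤n = Grassmannian.Indexed.conclusion F n k k<n
    (proj₂ (inhabited-size (B-inhabited (ℕ.<⇒≤ k<n)) (B-enumeration n k)))
    (proj₂ (inhabited-size (B-inhabited k<n) (B-enumeration n (suc k))))
  where
  open Subspaces F
  k<n : suc k ≤ n
  k<n = ℕ.≤-trans (ℕ.m≤m+n (suc k) _) 2m≤n
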